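{- For every integer $n\ge 1$, the $(n-1)$st reduced Betti number of the Stirling complex $\operatorname{St}(2n)$ is $n!$.
   Context: For a positive integer $m$, the Stirling complex $\operatorname{St}(m)$ is the simplicial complex whose vertices are the squares $(i,j)$ with $1\le i\le j\le m$ ($i$ is the column, $j$ the row) and whose faces are the non-attacking rook placements, i.e. the sets of squares no two of which lie in the same row or in the same column. The $k$th reduced Betti number is the rank of the $k$th reduced homology group. -}

module Defs where

open import Algebra.Bundles using (AbelianGroup)
open import Algebra.Structures using (IsAbelianGroup)
open import Data.Bool.Base using (true; false; if_then_else_)
open import Data.Fin.Base as Fin using (Fin; zero; suc; toℕ)
import Data.Fin.Properties as Fin
open import Data.Integer.Base as ℤ using (ℤ; +_; -[1+_]; 0ℤ; -1ℤ)
import Data.Integer.Properties as ℤ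
open import Data.Integer.Tactic.RingSolver using (solve-∀)
open import Data.List.Base as List using (List; []; _∷_; _++_; [_]; allFin; concatMap)
import Data.List.Properties as List
open import Data.List.Membership.Propositional using (_∈_)
open import Data.List.Relation.Binary.Subset.Propositional using (_⊆_)
open import Data.List.Relation.Unary.Any using (here; there)
open import Data.Nat.Base using (ℕ; zero; suc)
open import Data.Product.Base using (Σ; ∃; _×_; _,_; proj₁; proj₂)
open import Data.Product.Relation.Binary.Lex.Strict using (×-Lex; ×-isStrictTotalOrder)
open import Data.Vec.Base as Vec using (Vec; []; _∷_; toList; removeAt)
import Data.Vec.Properties as Vec
open import Data.Vec.Functional as Vector using (Vector)
open import Data.Vec.Relation.Unary.All using (All; []; _∷_)
open import Data.Vec.Relation.Unary.AllPairs using (AllPairs; []; _∷_)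
open import Function.Base using (_∘_; _on_)
open import Level using (0ℓ)
open import Relation.Binary.Core using (Rel)
open import Relation.Binary.Definitions using (Trichotomous; tri<; tri≈; tri>)
open import Relation.Binary.Structures using (IsStrictTotalOrder)
open import Relation.Binary.PropositionalEquality
  using (_≡_; _≢_; refl; sym; trans; cong; cong₂; isEquivalence; module ≡-Reasoning)
open import Relation.Nullary.Decidable.Core using (does)

module _ (G : AbelianGroup 0ℓ 0ℓ) where
  open AbelianGroup G
  open import Algebra.Definitions.RawMonoid rawMonoid
    using (sum) renaming (_×_ to _×ℕ_)

  infixr 8 _·_

  _·_ : ℤ → Carrier → Carrier
  (+ n)    · x = n ×ℕ x
  -[1+ n ] · x = (suc n ×ℕ x) ⁻¹

  combination : ∀ {r} → Vector ℤ r → Vector Carrier r → Carrier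
  combination c v = sum (λ i → c i · v i)

  LinearlyIndependent : ∀ {r} → Vector Carrier r → Set
  LinearlyIndependent v = ∀ c → combination c v ≈ ε → ∀ i → c i ≡ 0ℤ

  LinearlyDependent : ∀ {r} → Vector Carrier r → Set
  LinearlyDependent v = ∃ λ c → (∃ λ i → c i ≢ 0ℤ) × combination c v ≈ ε

  -- The rank is the size of a maximal ℤ-linearly independent family.
  HasRank : ℕ → Set
  HasRank r = Σ (Vector Carrier r) λ v →
    LinearlyIndependent v × (∀ x → LinearlyDependent (x Vector.∷ v))

-- A list stands for the finite set of its members: by ⊆-closed, IsFace
-- depends on that set only.  The total order on the vertices serves to
-- orient the simplices.
record SimplicialComplex : Set₁ where
  infix 4 _<_
  field
    Vertex             : Set
    _<_                : Rel Vertex 0ℓ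
    isStrictTotalOrder : IsStrictTotalOrder _≡_ _<_
    IsFace             : List Vertex → Set
    ⊆-closed           : ∀ {xs ys} → xs ⊆ ys → IsFace ys → IsFace xs
    []-isFace          : IsFace []
    vertex-isFace      : ∀ v → IsFace [ v ]

  open IsStrictTotalOrder isStrictTotalOrder public using (_≟_)

module _ {A : Set} where

  removeAt-All : ∀ {s} {P : A → Set} {xs : Vec A (suc s)} (i : Fin (suc s)) →
                 All P xs → All P (removeAt xs i)
  removeAt-All zero    (_ ∷ ps)           = ps
  removeAt-All (suc i) (p ∷ ps@(_ ∷ _)) = p ∷ removeAt-All i ps

  removeAt-AllPairs : ∀ {s} {R : Rel A 0ℓ} {xs : Vec A (suc s)} (i : Fin (suc s)) →
                      AllPairs R xs → AllPairs R (removeAt xs i)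
  removeAt-AllPairs zero    (_ ∷ ps)           = ps
  removeAt-AllPairs (suc i) (p ∷ ps@(_ ∷ _)) = removeAt-All i p ∷ removeAt-AllPairs i ps

  removeAt-⊆ : ∀ {s} (xs : Vec A (suc s)) (i : Fin (suc s)) →
               toList (removeAt xs i) ⊆ toList xs
  removeAt-⊆ (x ∷ xs)           zero    v∈         = there v∈
  removeAt-⊆ (x ∷ xs@(_ ∷ _)) (suc i) (here eq)  = here eq
  removeAt-⊆ (x ∷ xs@(_ ∷ _)) (suc i) (there v∈) = there (removeAt-⊆ xs i v∈)

module _ (K : SimplicialComplex) where
  open SimplicialComplex K

  -- A face with s vertices, i.e. of dimension s - 1, as the increasing
  -- sequence of its vertices; s = 0 gives the empty face.
  record Simplex (s : ℕ) : Set where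
    constructor simplex
    field
      vertices : Vec Vertex s
      sorted   : AllPairs _<_ vertices
      isFace   : IsFace (toList vertices)

  open Simplex

  omit : ∀ {s} → Simplex (suc s) → Fin (suc s) → Simplex s
  omit σ i = simplex
    (removeAt (vertices σ) i)
    (removeAt-AllPairs i (sorted σ))
    (⊆-closed (removeAt-⊆ (vertices σ) i) (isFace σ))

  -- Unreduced formal sums; two of them are equal as chains under _≈ᶜ_.
  Chain : ℕ → Set
  Chain s = List (ℤ × Simplex s)

  -- Simplices are compared through their vertices, so the proof fields
  -- play no role.
  coeff-term : ∀ {s} → ℤ × Simplex s → Simplex s → ℤ
  coeff-term (a , τ) σ =
    if does (Vec.≡-dec _≟_ (vertices τ) (vertices σ)) then a else 0ℤ

  coeff : ∀ {s} → Chain s → Simplex s → ℤ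
  coeff []      σ = 0ℤ
  coeff (t ∷ x) σ = coeff-term t σ ℤ.+ coeff x σ

  infix 4 _≈ᶜ_

  _≈ᶜ_ : ∀ {s} → Rel (Chain s) 0ℓ
  x ≈ᶜ y = ∀ σ → coeff x σ ≡ coeff y σ

  negate : ∀ {s} → Chain s → Chain s
  negate = List.map λ (a , σ) → (ℤ.- a , σ)

  -- ∂[v₀,…,vₛ] = Σᵢ (-1)ⁱ [v₀,…,v̂ᵢ,…,vₛ], extended linearly.  On vertices
  -- this is the augmentation, with values in the multiples of the empty face.
  ∂-term : ∀ {s} → ℤ × Simplex (suc s) → Chain s
  ∂-term (a , σ) = List.map (λ i → (a ℤ.* -1ℤ ℤ.^ toℕ i , omit σ i)) (allFin _)

  ∂ : ∀ {s} → Chain (suc s) → Chain s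
  ∂ = concatMap ∂-term

  coeff-++ : ∀ {s} (x y : Chain s) σ → coeff (x ++ y) σ ≡ coeff x σ ℤ.+ coeff y σ
  coeff-++ []      y σ = sym (ℤ.+-identityˡ _)
  coeff-++ (t ∷ x) y σ
    rewrite coeff-++ x y σ = sym (ℤ.+-assoc (coeff-term t σ) (coeff x σ) (coeff y σ))

  coeff-negate : ∀ {s} (x : Chain s) σ → coeff (negate x) σ ≡ ℤ.- coeff x σ
  coeff-negate []            σ = refl
  coeff-negate ((a , τ) ∷ x) σ
    rewrite coeff-negate x σ with does (Vec.≡-dec _≟_ (vertices τ) (vertices σ))
  ... | true  = sym (ℤ.neg-distrib-+ a (coeff x σ))
  ... | false = sym (ℤ.neg-distrib-+ 0ℤ (coeff x σ))

  ∂-++ : ∀ {s} (x y : Chain (suc s)) → ∂ (x ++ y) ≡ ∂ x ++ ∂ y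
  ∂-++ x y = List.concatMap-++ ∂-term x y

  ∂-negate : ∀ {s} (x : Chain (suc s)) → ∂ (negate x) ≡ negate (∂ x)
  ∂-negate []            = refl
  ∂-negate ((a , σ) ∷ x) = begin
    ∂-term (ℤ.- a , σ) ++ ∂ (negate x)     ≡⟨ cong₂ _++_ term (∂-negate x) ⟩
    negate (∂-term (a , σ)) ++ negate (∂ x) ≡⟨ List.map-++ _ (∂-term (a , σ)) (∂ x) ⟨
    negate (∂-term (a , σ) ++ ∂ x)          ∎
    where
    open ≡-Reasoning
    term : ∂-term (ℤ.- a , σ) ≡ negate (∂-term (a , σ))
    term = trans
      (List.map-cong (λ i → cong (λ b → (b , omit σ i)) (sym (ℤ.neg-distribˡ-* a _))) (allFin _))
      (List.map-∘ (allFin _))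

  coeff-∂-++ : ∀ {s} (x y : Chain (suc s)) σ →
               coeff (∂ (x ++ y)) σ ≡ coeff (∂ x) σ ℤ.+ coeff (∂ y) σ
  coeff-∂-++ x y σ = trans (cong (λ z → coeff z σ) (∂-++ x y)) (coeff-++ (∂ x) (∂ y) σ)

  coeff-∂-negate : ∀ {s} (x : Chain (suc s)) σ → coeff (∂ (negate x)) σ ≡ ℤ.- coeff (∂ x) σ
  coeff-∂-negate x σ = trans (cong (λ z → coeff z σ) (∂-negate x)) (coeff-negate (∂ x) σ)

  module _ (k : ℕ) where

    Cycle : Set
    Cycle = Σ (Chain (suc k)) λ z → ∂ z ≈ᶜ []

    infix 4 _~_

    _~_ : Rel Cycle 0ℓ
    (x , _) ~ (y , _) = ∃ λ w → x ≈ᶜ y ++ ∂ w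

    _+ᶻ_ : Cycle → Cycle → Cycle
    (x , ∂x≈0) +ᶻ (y , ∂y≈0) =
      x ++ y , λ σ → trans (coeff-∂-++ x y σ) (cong₂ ℤ._+_ (∂x≈0 σ) (∂y≈0 σ))

    0ᶻ : Cycle
    0ᶻ = [] , λ _ → refl

    -ᶻ_ : Cycle → Cycle
    -ᶻ (x , ∂x≈0) = negate x , λ σ → trans (coeff-∂-negate x σ) (cong ℤ.-_ (∂x≈0 σ))

    private
      ≈⇒~ : ∀ {x y : Cycle} → proj₁ x ≈ᶜ proj₁ y → x ~ y
      ≈⇒~ {y = y , _} x≈y =
        [] , λ σ → trans (x≈y σ) (cong (λ z → coeff z σ) (sym (List.++-identityʳ y)))

      out : ∀ {x y : Chain (suc k)} w → x ≈ᶜ y ++ ∂ w → ∀ σ → coeff x σ ≡ coeff y σ ℤ.+ coeff (∂ w) σ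
      out {y = y} w p σ = trans (p σ) (coeff-++ y (∂ w) σ)

      into : ∀ {x y : Chain (suc k)} w → (∀ σ → coeff x σ ≡ coeff y σ ℤ.+ coeff (∂ w) σ) → x ≈ᶜ y ++ ∂ w
      into {y = y} w p σ = trans (p σ) (sym (coeff-++ y (∂ w) σ))

      ~-sym : ∀ {x y} → x ~ y → y ~ x
      ~-sym {x , _} {y , _} (w , p) = negate w , into {y} {x} (negate w) λ σ →
        trans (lemma (coeff y σ) (coeff (∂ w) σ))
              (cong₂ ℤ._+_ (sym (out {x} {y} w p σ)) (sym (coeff-∂-negate w σ)))
        where
        lemma : ∀ b c → b ≡ (b ℤ.+ c) ℤ.+ ℤ.- c
        lemma = solve-∀

      ~-trans : ∀ {x y z} → x ~ y → y ~ z → x ~ z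
      ~-trans {x , _} {y , _} {z , _} (v , p) (w , q) = w ++ v , into {x} {z} (w ++ v) λ σ →
        trans (out {x} {y} v p σ)
        (trans (cong (ℤ._+ coeff (∂ v) σ) (out {y} {z} w q σ))
        (trans (ℤ.+-assoc (coeff z σ) _ _)
               (cong (ℤ._+_ (coeff z σ)) (sym (coeff-∂-++ w v σ)))))

      +-cong : ∀ {x y u v} → x ~ y → u ~ v → (x +ᶻ u) ~ (y +ᶻ v)
      +-cong {x , _} {y , _} {u , _} {v , _} (w , p) (w′ , q) =
        w ++ w′ , into {x ++ u} {y ++ v} (w ++ w′) λ σ →
        trans (coeff-++ x u σ)
        (trans (cong₂ ℤ._+_ (out {x} {y} w p σ) (out {u} {v} w′ q σ))
        (trans (lemma (coeff y σ) _ (coeff v σ) _)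
               (cong₂ ℤ._+_ (sym (coeff-++ y v σ)) (sym (coeff-∂-++ w w′ σ)))))
        where
        lemma : ∀ a b c d → (a ℤ.+ b) ℤ.+ (c ℤ.+ d) ≡ (a ℤ.+ c) ℤ.+ (b ℤ.+ d)
        lemma = solve-∀

      neg-cong : ∀ {x y} → x ~ y → (-ᶻ x) ~ (-ᶻ y)
      neg-cong {x , _} {y , _} (w , p) =
        negate w , into {negate x} {negate y} (negate w) λ σ →
        trans (coeff-negate x σ)
        (trans (cong ℤ.-_ (out {x} {y} w p σ))
        (trans (ℤ.neg-distrib-+ (coeff y σ) _)
               (cong₂ ℤ._+_ (sym (coeff-negate y σ)) (sym (coeff-∂-negate w σ)))))

      ++-comm : ∀ {s} (x y : Chain s) → x ++ y ≈ᶜ y ++ x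
      ++-comm x y σ = trans (coeff-++ x y σ)
        (trans (ℤ.+-comm (coeff x σ) _) (sym (coeff-++ y x σ)))

      ++-inverseˡ : ∀ {s} (x : Chain s) → negate x ++ x ≈ᶜ []
      ++-inverseˡ x σ = trans (coeff-++ (negate x) x σ)
        (trans (cong (ℤ._+ coeff x σ) (coeff-negate x σ)) (ℤ.+-inverseˡ (coeff x σ)))

      isAbelianGroup : IsAbelianGroup _~_ _+ᶻ_ 0ᶻ -ᶻ_
      isAbelianGroup = record
        { isGroup = record
          { isMonoid = record
            { isSemigroup = record
              { isMagma = record
                { isEquivalence = record
                  { refl  = λ {x} → ≈⇒~ {x} {x} (λ _ → refl)
                  ; sym   = λ {x} {y} → ~-sym {x} {y}
                  ; trans = λ {x} {y} {z} → ~-trans {x} {y} {z}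
                  }
                ; ∙-cong = λ {x} {y} {u} {v} → +-cong {x} {y} {u} {v}
                }
              ; assoc = λ x y z → ≈⇒~ {(x +ᶻ y) +ᶻ z} {x +ᶻ (y +ᶻ z)} λ σ →
                  cong (λ c → coeff c σ) (List.++-assoc (proj₁ x) (proj₁ y) (proj₁ z))
              }
            ; identity = (λ x → ≈⇒~ {0ᶻ +ᶻ x} {x} (λ _ → refl))
                       , (λ x → ≈⇒~ {x +ᶻ 0ᶻ} {x} λ σ →
                           cong (λ c → coeff c σ) (List.++-identityʳ (proj₁ x)))
            }
          ; inverse = (λ x → ≈⇒~ {(-ᶻ x) +ᶻ x} {0ᶻ} (++-inverseˡ (proj₁ x)))
                    , (λ x → ≈⇒~ {x +ᶻ (-ᶻ x)} {0ᶻ} λ σ →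
                        trans (++-comm (proj₁ x) (negate (proj₁ x)) σ)
                              (++-inverseˡ (proj₁ x) σ))
          ; ⁻¹-cong = λ {x} {y} → neg-cong {x} {y}
          }
        ; comm = λ x y → ≈⇒~ {x +ᶻ y} {y +ᶻ x} (++-comm (proj₁ x) (proj₁ y))
        }

    -- Indexed by dimension: k-simplices have k + 1 vertices.  For k = 0 the
    -- condition ∂ z ≈ᶜ [] is the vanishing of the augmentation, which makes
    -- the homology reduced.
    ReducedHomology : AbelianGroup 0ℓ 0ℓ
    ReducedHomology = record { isAbelianGroup = isAbelianGroup }

HasReducedBetti : SimplicialComplex → ℕ → ℕ → Set
HasReducedBetti K k b = HasRank (ReducedHomology K k) b

-- Columns and rows are numbered from 0 instead of 1.
record Square (m : ℕ) : Set where
  constructor square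
  field
    col row  : Fin m
    .col≤row : col Fin.≤ row

open Square

NonAttacking : ∀ {m} → List (Square m) → Set
NonAttacking p = ∀ {s t} → s ∈ p → t ∈ p → s ≢ t → col s ≢ col t × row s ≢ row t

module _ {m : ℕ} where

  coordinates : Square m → Fin m × Fin m
  coordinates s = col s , row s

  _<ˢ_ : Rel (Square m) 0ℓ
  _<ˢ_ = ×-Lex _≡_ Fin._<_ Fin._<_ on coordinates

  private
    module Lex = IsStrictTotalOrder
      (×-isStrictTotalOrder (Fin.<-isStrictTotalOrder {m}) (Fin.<-isStrictTotalOrder {m}))

    <ˢ-compare : Trichotomous _≡_ _<ˢ_
    <ˢ-compare s t with Lex.compare (coordinates s) (coordinates t)
    ... | tri< lt ne gt            = tri< lt (λ { refl → ne (refl , refl) }) gt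
    ... | tri≈ lt (refl , refl) gt = tri≈ lt refl gt
    ... | tri> lt ne gt            = tri> lt (λ { refl → ne (refl , refl) }) gt

  <ˢ-isStrictTotalOrder : IsStrictTotalOrder _≡_ _<ˢ_
  <ˢ-isStrictTotalOrder = record
    { isStrictPartialOrder = record
      { isEquivalence = isEquivalence
      ; irrefl        = λ { refl → Lex.irrefl (refl , refl) }
      ; trans         = Lex.trans
      ; <-resp-≈      = (λ { refl lt → lt }) , (λ { refl lt → lt })
      }
    ; compare = <ˢ-compare
    }

St : ℕ → SimplicialComplex
St m = record
  { Vertex             = Square m
  ; _<_                = _<ˢ_
  ; isStrictTotalOrder = <ˢ-isStrictTotalOrder
  ; IsFace             = NonAttacking
  ; ⊆-closed           = λ xs⊆ys na s∈ t∈ → na (xs⊆ys s∈) (xs⊆ys t∈)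
  ; []-isFace          = λ ()
  ; vertex-isFace      = λ { v (here refl) (here refl) s≢t → ⊥-elim (s≢t refl) }
  }
  where open import Data.Empty using (⊥-elim)

module Submission where

-- A placement of rooks is joined to the vertex (i,i) of the reference simplex
-- {(1,1),…,(2n,2n)} unless i is the column or the row of one of its
-- off-diagonal rooks.  A placement of n rooks has 2n coordinates, so it lies in
-- the star cluster of the reference simplex (the union of the stars of the
-- (i,i)), which is acyclic, unless its coordinates are the 2n indices, each
-- occurring once; call it perfect in that case.  If a perfect placement has a
-- row b and a column a with b < a, then adding the rook (b,a) gives a simplex
-- with no other perfect face, so the placement can be eliminated from every
-- cycle.  The remaining perfect placements are {(i, n + π i) : i ≤ n} for the
-- n! permutations π.  They are maximal simplices, so their coefficients in a
-- cycle depend on the homology class only, and the one of π occurs in exactly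
-- one of the n! cross-polytopes spanned by the pairs (i,i), (i, n + π i).

open import Defs
open import Data.Nat.Base using (ℕ; _*_; _∸_; _≥_; _!)
open import Algebra.Bundles using (AbelianGroup)
open import Data.Nat.Base as ℕ using (zero; suc; z≤n; s≤s)
import Data.Nat.Properties as ℕ
open import Data.Bool.Base using (Bool; true; false; not; if_then_else_)
open import Data.Empty using (⊥)
open import Data.Fin.Base as Fin
  using (Fin; zero; suc; toℕ; punchIn; punchOut; combine; remQuot; _↑ˡ_; _↑ʳ_; cast; join; splitAt; fromℕ<)
import Data.Fin.Properties as Fin
open import Data.Integer.Base as ℤ using (ℤ; +_; -[1+_]; 0ℤ; 1ℤ; -1ℤ)
import Data.Integer.Properties as ℤ
open import Data.Integer.Tactic.RingSolver using (solve-∀)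
open import Data.List.Base as List using (List; []; _∷_; _++_; [_]; allFin; length)
import Data.List.Properties as List
open import Data.List.Membership.Propositional using (_∈_; _∉_)
open import Data.List.Relation.Binary.Subset.Propositional using (_⊆_)
open import Data.List.Relation.Unary.Any using (here; there; any?)
open import Data.Product.Base using (∃; _×_; _,_; proj₁; proj₂)
open import Data.Sum.Base using (_⊎_; inj₁; inj₂; [_,_]′)
open import Data.Vec.Base as Vec using (Vec; []; _∷_; toList; removeAt; insertAt; lookup)
import Data.Vec.Properties as Vec
open import Data.Vec.Relation.Unary.All as All using (All; []; _∷_)
open import Data.Vec.Relation.Unary.AllPairs using (AllPairs; []; _∷_)
open import Data.Vec.Functional as Vector using (Vector)
open import Function.Base using (_∘_)
open import Level using (0ℓ)
open import Relation.Binary.Core using (Rel)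
open import Relation.Binary.Definitions using (tri<; tri≈; tri>)
open import Relation.Binary.Structures using (IsStrictTotalOrder)
open import Relation.Binary.PropositionalEquality
  using (_≡_; _≢_; refl; sym; trans; cong; cong₂; subst; subst₂; module ≡-Reasoning)
open import Relation.Nullary.Decidable.Core using (Dec; does; yes; no; recompute; _→-dec_; _×-dec_; _⊎-dec_; ¬?)
open import Relation.Nullary.Decidable using (dec-true; dec-false)
open import Relation.Nullary.Negation.Core using (¬_; contradiction)
open import Relation.Unary using (Decidable)

open ≡-Reasoning

-- Finite sums and signs

module _ {A : Set} where

  ∑ : List A → (A → ℤ) → ℤ
  ∑ []       f = 0ℤ
  ∑ (x ∷ xs) f = f x ℤ.+ ∑ xs f

  ∑-cong : ∀ xs {f g : A → ℤ} → (∀ x → f x ≡ g x) → ∑ xs f ≡ ∑ xs g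
  ∑-cong []       eq = refl
  ∑-cong (x ∷ xs) eq = cong₂ ℤ._+_ (eq x) (∑-cong xs eq)

  ∑-zero : ∀ xs {f : A → ℤ} → (∀ x → f x ≡ 0ℤ) → ∑ xs f ≡ 0ℤ
  ∑-zero []       eq = refl
  ∑-zero (x ∷ xs) eq rewrite eq x | ∑-zero xs eq = refl

  ∑-++ : ∀ xs ys (f : A → ℤ) → ∑ (xs ++ ys) f ≡ ∑ xs f ℤ.+ ∑ ys f
  ∑-++ []       ys f = sym (ℤ.+-identityˡ _)
  ∑-++ (x ∷ xs) ys f rewrite ∑-++ xs ys f = sym (ℤ.+-assoc (f x) _ _)

  ∑-+ : ∀ xs (f g : A → ℤ) → ∑ xs (λ x → f x ℤ.+ g x) ≡ ∑ xs f ℤ.+ ∑ xs g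
  ∑-+ []       f g = refl
  ∑-+ (x ∷ xs) f g rewrite ∑-+ xs f g = interchange (f x) (g x) _ _
    where
    interchange : ∀ a b c d → (a ℤ.+ b) ℤ.+ (c ℤ.+ d) ≡ (a ℤ.+ c) ℤ.+ (b ℤ.+ d)
    interchange = solve-∀

  ∑-*ˡ : ∀ c xs (f : A → ℤ) → ∑ xs (λ x → c ℤ.* f x) ≡ c ℤ.* ∑ xs f
  ∑-*ˡ c []       f = sym (ℤ.*-zeroʳ c)
  ∑-*ˡ c (x ∷ xs) f rewrite ∑-*ˡ c xs f = sym (ℤ.*-distribˡ-+ c (f x) _)

∑-map : ∀ {A B : Set} (h : A → B) xs (f : B → ℤ) → ∑ (List.map h xs) f ≡ ∑ xs (f ∘ h)
∑-map h []       f = refl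
∑-map h (x ∷ xs) f = cong (ℤ._+_ (f (h x))) (∑-map h xs f)

∑-swap : ∀ {A B : Set} xs ys (f : A → B → ℤ) →
         ∑ xs (λ x → ∑ ys (f x)) ≡ ∑ ys (λ y → ∑ xs (λ x → f x y))
∑-swap []       ys f = sym (∑-zero ys (λ _ → refl))
∑-swap (x ∷ xs) ys f = trans (cong (ℤ._+_ (∑ ys (f x))) (∑-swap xs ys f)) (sym (∑-+ ys _ _))

∑-single : ∀ {n} (i : Fin n) {f : Fin n → ℤ} → (∀ j → j ≢ i → f j ≡ 0ℤ) → ∑ (allFin n) f ≡ f i
∑-single {suc n} i {f} off = trans (cong (λ z → f zero ℤ.+ z) (tabulate-suc f)) (go i off)
  where
  tabulate-suc : ∀ (f : Fin (suc n) → ℤ) → ∑ (List.tabulate suc) f ≡ ∑ (allFin n) (f ∘ suc)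
  tabulate-suc f = trans (cong (λ l → ∑ l f) (sym (List.map-tabulate (λ i → i) suc))) (∑-map suc (allFin n) f)
  go : ∀ i → (∀ j → j ≢ i → f j ≡ 0ℤ) → f zero ℤ.+ ∑ (allFin n) (f ∘ suc) ≡ f i
  go zero off = trans (cong (ℤ._+_ (f zero)) (∑-zero (allFin n) (λ j → off (suc j) λ ()))) (ℤ.+-identityʳ _)
  go (suc i) off = trans (cong₂ ℤ._+_ (off zero λ ())
                     (∑-single i (λ j j≢i → off (suc j) (j≢i ∘ Fin.suc-injective))))
                     (ℤ.+-identityˡ _)

sign : ℕ → ℤ
sign i = -1ℤ ℤ.^ i

sign-square : ∀ i → sign i ℤ.* sign i ≡ 1ℤ
sign-square zero    = refl
sign-square (suc i) = trans (lemma (sign i)) (sign-square i)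
  where
  lemma : ∀ a → (-1ℤ ℤ.* a) ℤ.* (-1ℤ ℤ.* a) ≡ a ℤ.* a
  lemma = solve-∀

sign-cancel : ∀ i {a} → sign i ℤ.* a ≡ 0ℤ → a ≡ 0ℤ
sign-cancel i {a} eq = begin
  a                         ≡⟨ ℤ.*-identityˡ a ⟨
  1ℤ ℤ.* a                  ≡⟨ cong (ℤ._* a) (sign-square i) ⟨
  sign i ℤ.* sign i ℤ.* a   ≡⟨ ℤ.*-assoc (sign i) _ a ⟩
  sign i ℤ.* (sign i ℤ.* a) ≡⟨ cong (sign i ℤ.*_) eq ⟩
  sign i ℤ.* 0ℤ             ≡⟨ ℤ.*-zeroʳ (sign i) ⟩
  0ℤ                        ∎

-- Vectors with one entry omitted, and sorted vectors

module _ {A : Set} where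

  ∈⇒lookup⊎removeAt : ∀ {s} (xs : Vec A (suc s)) p {x} → x ∈ toList xs →
                      x ≡ lookup xs p ⊎ x ∈ toList (removeAt xs p)
  ∈⇒lookup⊎removeAt (x ∷ xs)         zero    (here eq)  = inj₁ eq
  ∈⇒lookup⊎removeAt (x ∷ xs)         zero    (there x∈) = inj₂ x∈
  ∈⇒lookup⊎removeAt (x ∷ xs@(_ ∷ _)) (suc p) (here eq)  = inj₂ (here eq)
  ∈⇒lookup⊎removeAt (x ∷ xs@(_ ∷ _)) (suc p) (there x∈) with ∈⇒lookup⊎removeAt xs p x∈
  ... | inj₁ eq  = inj₁ eq
  ... | inj₂ x∈′ = inj₂ (there x∈′)

  lookup-∈ : ∀ {s} (xs : Vec A s) p → lookup xs p ∈ toList xs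
  lookup-∈ (x ∷ xs) zero    = here refl
  lookup-∈ (x ∷ xs) (suc p) = there (lookup-∈ xs p)

  ∈⇒lookup : ∀ {s} (xs : Vec A s) {x} → x ∈ toList xs → ∃ λ p → lookup xs p ≡ x
  ∈⇒lookup (x ∷ xs) (here refl) = zero , refl
  ∈⇒lookup (x ∷ xs) (there x∈) with p , eq ← ∈⇒lookup xs x∈ = suc p , eq

  lookup-∈-removeAt : ∀ {s} (xs : Vec A (suc s)) p q → q ≢ p → lookup xs p ∈ toList (removeAt xs q)
  lookup-∈-removeAt (x ∷ xs)         zero    zero    q≢p = contradiction refl q≢p
  lookup-∈-removeAt (x ∷ xs)         (suc p) zero    q≢p = lookup-∈ xs p
  lookup-∈-removeAt (x ∷ xs@(_ ∷ _)) zero    (suc q) q≢p = here refl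
  lookup-∈-removeAt (x ∷ xs@(_ ∷ _)) (suc p) (suc q) q≢p =
    there (lookup-∈-removeAt xs p q (q≢p ∘ cong suc))

  All-∈ : ∀ {s} {P : A → Set} {xs : Vec A s} → All P xs → ∀ {x} → x ∈ toList xs → P x
  All-∈ (p ∷ ps) (here refl) = p
  All-∈ (p ∷ ps) (there x∈)  = All-∈ ps x∈

  ∈-All : ∀ {s} {P : A → Set} (xs : Vec A s) → (∀ {x} → x ∈ toList xs → P x) → All P xs
  ∈-All []       f = []
  ∈-All (x ∷ xs) f = f (here refl) ∷ ∈-All xs (f ∘ there)

module Sorted {A : Set} {_<_ : Rel A 0ℓ} (isSTO : IsStrictTotalOrder _≡_ _<_) where
  open IsStrictTotalOrder isSTO using (compare; irrefl) renaming (trans to <-trans)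

  lookup-∉-removeAt : ∀ {s} (xs : Vec A (suc s)) p → AllPairs _<_ xs →
                      lookup xs p ∉ toList (removeAt xs p)
  lookup-∉-removeAt (x ∷ xs)         zero    (x< ∷ _)  ∈xs        = irrefl refl (All-∈ x< ∈xs)
  lookup-∉-removeAt (x ∷ xs@(_ ∷ _)) (suc p) (x< ∷ _)  (here eq)  =
    irrefl (sym eq) (All-∈ x< (lookup-∈ xs p))
  lookup-∉-removeAt (x ∷ xs@(_ ∷ _)) (suc p) (_ ∷ srt) (there ∈r) = lookup-∉-removeAt xs p srt ∈r

  -- Each head is the minimum of the common set, so trichotomy forces the heads to agree; strictness
  -- keeps the head out of the tail, so both inclusions pass to the tails.
  sorted-ext : ∀ {s} {xs ys : Vec A s} → AllPairs _<_ xs → AllPairs _<_ ys →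
               toList xs ⊆ toList ys → toList ys ⊆ toList xs → xs ≡ ys
  sorted-ext {xs = []}     {[]}     _ _ _ _ = refl
  sorted-ext {xs = x ∷ xs} {y ∷ ys} (x< ∷ sx) (y< ∷ sy) x⊆y y⊆x = cong₂ _∷_ x≡y
    (sorted-ext sx sy (tail⊆ x< x≡y x⊆y) (tail⊆ y< (sym x≡y) y⊆x))
    where
    min : ∀ {s} {z u} {us : Vec A s} → All (u <_) us → z ∈ toList (u ∷ us) → ¬ z < u
    min u< (here refl) z<u = irrefl refl z<u
    min u< (there z∈)  z<u = irrefl refl (<-trans z<u (All-∈ u< z∈))
    x≡y : x ≡ y
    x≡y with compare x y
    ... | tri< x<y _ _ = contradiction x<y (min y< (x⊆y (here refl)))
    ... | tri≈ _ eq _  = eq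
    ... | tri> _ _ y<x = contradiction y<x (min x< (y⊆x (here refl)))
    tail⊆ : ∀ {s} {u v} {us vs : Vec A s} → All (u <_) us → u ≡ v →
            toList (u ∷ us) ⊆ toList (v ∷ vs) → toList us ⊆ toList vs
    tail⊆ u< u≡v ⊆ z∈ with ⊆ (there z∈)
    ... | here z≡v = contradiction (All-∈ u< z∈) (irrefl (trans u≡v (sym z≡v)))
    ... | there z∈′ = z∈′

  insertion : ∀ {s} (xs : Vec A s) v → AllPairs _<_ xs → v ∉ toList xs →
              ∃ λ p → AllPairs _<_ (insertAt xs p v)
  insertion []       v [] v∉ = zero , [] ∷ []
  insertion (x ∷ xs) v (x< ∷ sx) v∉ with compare v x
  ... | tri< v<x _ _ = zero , (v<x ∷ All.map (<-trans v<x) x<) ∷ x< ∷ sx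
  ... | tri≈ _ eq _  = contradiction (here eq) v∉
  ... | tri> _ _ x<v with p , srt ← insertion xs v sx (v∉ ∘ there) =
        suc p , All-insertAt p x< ∷ srt
    where
    All-insertAt : ∀ {s} {us : Vec A s} p → All (x <_) us → All (x <_) (insertAt us p v)
    All-insertAt zero    us        = x<v ∷ us
    All-insertAt (suc p) (u ∷ us) = u ∷ All-insertAt p us

-- Chains and boundaries

module _ (K : SimplicialComplex) where
  open SimplicialComplex K
  open Simplex
  open Sorted isStrictTotalOrder

  _≟ᵛ_ : ∀ {s} (xs ys : Vec Vertex s) → Dec (xs ≡ ys)
  _≟ᵛ_ = Vec.≡-dec _≟_

  abstract
    -- The indicator cochain of `c`. It is sealed because only its values on equal and on different
    -- vectors and its link with `coeff-term` are used.
    δ : ∀ {s} → Vec Vertex s → Vec Vertex s → ℤ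
    δ c u = if does (u ≟ᵛ c) then 1ℤ else 0ℤ

    δ-≡ : ∀ {s} {c u : Vec Vertex s} → u ≡ c → δ c u ≡ 1ℤ
    δ-≡ {c = c} {u} eq rewrite dec-true (u ≟ᵛ c) eq = refl

    δ-≢ : ∀ {s} {c u : Vec Vertex s} → u ≢ c → δ c u ≡ 0ℤ
    δ-≢ {c = c} {u} neq rewrite dec-false (u ≟ᵛ c) neq = refl

    coeff-term-δ : ∀ {s} a τ (σ : Simplex K s) → coeff-term K (a , τ) σ ≡ a ℤ.* δ (vertices σ) (vertices τ)
    coeff-term-δ a τ σ with does (vertices τ ≟ᵛ vertices σ)
    ... | true  = sym (ℤ.*-identityʳ a)
    ... | false = sym (ℤ.*-zeroʳ a)

  weight : ∀ {s} → (Vec Vertex s → ℤ) → ℤ × Simplex K s → ℤ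
  weight f (a , τ) = a ℤ.* f (vertices τ)

  -- Cochains are functions on all vertex vectors, faces or not, so that no proof of being a face
  -- has to be carried along.
  ⟨_,_⟩ : ∀ {s} → Chain K s → (Vec Vertex s → ℤ) → ℤ
  ⟨ x , f ⟩ = ∑ x (weight f)

  coeff-pairing : ∀ {s} (x : Chain K s) σ → coeff K x σ ≡ ⟨ x , δ (vertices σ) ⟩
  coeff-pairing []            σ = refl
  coeff-pairing ((a , τ) ∷ x) σ = cong₂ ℤ._+_ (coeff-term-δ a τ σ) (coeff-pairing x σ)

  -- Transpose of ∂ under the pairing ⟨_,_⟩.
  coboundary : ∀ {s} → (Vec Vertex s → ℤ) → Vec Vertex (suc s) → ℤ
  coboundary f u = ∑ (allFin _) λ i → sign (toℕ i) ℤ.* f (removeAt u i)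

  ⟨∂,⟩ : ∀ {s} (x : Chain K (suc s)) f → ⟨ ∂ K x , f ⟩ ≡ ⟨ x , coboundary f ⟩
  ⟨∂,⟩ []            f = refl
  ⟨∂,⟩ {s} ((a , τ) ∷ x) f =
    trans (∑-++ (∂-term K (a , τ)) (∂ K x) (weight f)) (cong₂ ℤ._+_ term (⟨∂,⟩ x f))
    where
    term : ⟨ ∂-term K (a , τ) , f ⟩ ≡ a ℤ.* coboundary f (vertices τ)
    term = trans
      (∑-map (λ i → a ℤ.* sign (toℕ i) , omit K τ i) (allFin (suc s)) (weight f))
      (trans (∑-cong (allFin (suc s)) (λ i → ℤ.*-assoc a (sign (toℕ i)) (f (removeAt (vertices τ) i))))
             (∑-*ˡ a (allFin (suc s)) (λ i → sign (toℕ i) ℤ.* f (removeAt (vertices τ) i))))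

  -- The face omitting `x` has sign +1; every other face keeps `x` in front and has its index
  -- shifted by one, which reverses its sign.
  coboundary-∷ : ∀ {s} (f : Vec Vertex (suc s) → ℤ) x (u : Vec Vertex (suc s)) →
                 coboundary f (x ∷ u) ≡ f u ℤ.- coboundary (f ∘ (x ∷_)) u
  coboundary-∷ {s} f x u@(_ ∷ _) = cong₂ ℤ._+_ (ℤ.*-identityˡ (f u)) (begin
    ∑ (List.tabulate suc) g
      ≡⟨ cong (λ l → ∑ l g) (List.map-tabulate (λ i → i) suc) ⟨
    ∑ (List.map suc (allFin (suc s))) g
      ≡⟨ ∑-map suc (allFin (suc s)) g ⟩
    ∑ (allFin (suc s)) (λ i → -1ℤ ℤ.* sign (toℕ i) ℤ.* h i)
      ≡⟨ ∑-cong (allFin (suc s)) (λ i → ℤ.*-assoc -1ℤ (sign (toℕ i)) (h i)) ⟩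
    ∑ (allFin (suc s)) (λ i → -1ℤ ℤ.* (sign (toℕ i) ℤ.* h i))
      ≡⟨ ∑-*ˡ -1ℤ (allFin (suc s)) (λ i → sign (toℕ i) ℤ.* h i) ⟩
    -1ℤ ℤ.* coboundary (f ∘ (x ∷_)) u
      ≡⟨ ℤ.-1*i≡-i _ ⟩
    ℤ.- coboundary (f ∘ (x ∷_)) u ∎)
    where
    g : Fin (suc (suc s)) → ℤ
    g i = sign (toℕ i) ℤ.* f (removeAt (x ∷ u) i)
    h : Fin (suc s) → ℤ
    h i = f (x ∷ removeAt u i)

  coboundary-cong : ∀ {s} {f g : Vec Vertex s → ℤ} → (∀ u → f u ≡ g u) → ∀ u → coboundary f u ≡ coboundary g u
  coboundary-cong eq u = ∑-cong (allFin _) λ i → cong (sign (toℕ i) ℤ.*_) (eq (removeAt u i))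

  coboundary-minus : ∀ {s} (f g : Vec Vertex s → ℤ) u →
                     coboundary (λ r → f r ℤ.- g r) u ≡ coboundary f u ℤ.- coboundary g u
  coboundary-minus {s} f g u = begin
    ∑ (allFin (suc s)) (λ i → sign (toℕ i) ℤ.* (f (removeAt u i) ℤ.- g (removeAt u i)))
      ≡⟨ ∑-cong (allFin (suc s)) (λ i → lemma (sign (toℕ i)) (f (removeAt u i)) (g (removeAt u i))) ⟩
    ∑ (allFin (suc s)) (λ i → F i ℤ.+ -1ℤ ℤ.* G i)
      ≡⟨ ∑-+ (allFin (suc s)) F (λ i → -1ℤ ℤ.* G i) ⟩
    coboundary f u ℤ.+ ∑ (allFin (suc s)) (λ i → -1ℤ ℤ.* G i)
      ≡⟨ cong (ℤ._+_ (coboundary f u)) (trans (∑-*ˡ -1ℤ (allFin (suc s)) G) (ℤ.-1*i≡-i _)) ⟩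
    coboundary f u ℤ.- coboundary g u ∎
    where
    F G : Fin (suc s) → ℤ
    F i = sign (toℕ i) ℤ.* f (removeAt u i)
    G i = sign (toℕ i) ℤ.* g (removeAt u i)
    lemma : ∀ e a b → e ℤ.* (a ℤ.- b) ≡ e ℤ.* a ℤ.+ -1ℤ ℤ.* (e ℤ.* b)
    lemma = solve-∀

  -- Peeling off the first vertex `x` with `coboundary-∷` twice leaves two copies of
  -- `coboundary f u` that cancel, and the double coboundary of `f ∘ (x ∷_)`, a smaller case.
  coboundary-coboundary : ∀ {s} (f : Vec Vertex s → ℤ) u → coboundary (coboundary f) u ≡ 0ℤ
  coboundary-coboundary {zero} f (x ∷ y ∷ []) = lemma (f [])
    where
    lemma : ∀ a → 1ℤ ℤ.* (1ℤ ℤ.* a ℤ.+ 0ℤ) ℤ.+ (-1ℤ ℤ.* (1ℤ ℤ.* a ℤ.+ 0ℤ) ℤ.+ 0ℤ) ≡ 0ℤ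
    lemma = solve-∀
  coboundary-coboundary {suc s} f (x ∷ u) = begin
    coboundary (coboundary f) (x ∷ u)
      ≡⟨ coboundary-∷ (coboundary f) x u ⟩
    coboundary f u ℤ.- coboundary (coboundary f ∘ (x ∷_)) u
      ≡⟨ cong (ℤ._-_ (coboundary f u)) (trans (coboundary-cong (coboundary-∷ f x) u)
           (coboundary-minus f (coboundary (f ∘ (x ∷_))) u)) ⟩
    coboundary f u ℤ.- (coboundary f u ℤ.- coboundary (coboundary (f ∘ (x ∷_))) u)
      ≡⟨ cong (λ a → coboundary f u ℤ.- (coboundary f u ℤ.- a)) (coboundary-coboundary (f ∘ (x ∷_)) u) ⟩
    coboundary f u ℤ.- (coboundary f u ℤ.- 0ℤ)
      ≡⟨ lemma (coboundary f u) ⟩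
    0ℤ ∎
    where
    lemma : ∀ a → a ℤ.- (a ℤ.- 0ℤ) ≡ 0ℤ
    lemma = solve-∀

  abstract
    -- The classical incidence number: the coefficient of `c` in the boundary of the second
    -- argument.
    incidence : ∀ {s} → Vec Vertex s → Vec Vertex (suc s) → ℤ
    incidence c = coboundary (δ c)

    incidence-coboundary : ∀ {s} (c : Vec Vertex s) → incidence c ≡ coboundary (δ c)
    incidence-coboundary c = refl

    incidence-zero : ∀ {s} {c : Vec Vertex s} {u} → (∀ i → removeAt u i ≢ c) → incidence c u ≡ 0ℤ
    incidence-zero {u = u} not = ∑-zero (allFin _) λ i →
      trans (cong (sign (toℕ i) ℤ.*_) (δ-≢ (not i))) (ℤ.*-zeroʳ (sign (toℕ i)))

    incidence-single : ∀ {s} {c : Vec Vertex s} {u} p → (∀ i → i ≢ p → removeAt u i ≢ c) →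
                       incidence c u ≡ sign (toℕ p) ℤ.* δ c (removeAt u p)
    incidence-single {u = u} p not = ∑-single p λ i i≢p →
      trans (cong (sign (toℕ i) ℤ.*_) (δ-≢ (not i i≢p))) (ℤ.*-zeroʳ (sign (toℕ i)))

  coeff-∂ : ∀ {s} (x : Chain K (suc s)) σ → coeff K (∂ K x) σ ≡ ⟨ x , incidence (vertices σ) ⟩
  coeff-∂ x σ = trans (coeff-pairing (∂ K x) σ) (trans (⟨∂,⟩ x (δ (vertices σ)))
    (cong (λ f → ⟨ x , f ⟩) (sym (incidence-coboundary (vertices σ)))))

  ∂∂≈0 : ∀ {s} (w : Chain K (suc (suc s))) → _≈ᶜ_ K (∂ K (∂ K w)) []
  ∂∂≈0 w σ = begin
    coeff K (∂ K (∂ K w)) σ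
      ≡⟨ coeff-pairing (∂ K (∂ K w)) σ ⟩
    ⟨ ∂ K (∂ K w) , δ (vertices σ) ⟩
      ≡⟨ ⟨∂,⟩ (∂ K w) (δ (vertices σ)) ⟩
    ⟨ ∂ K w , coboundary (δ (vertices σ)) ⟩
      ≡⟨ ⟨∂,⟩ w (coboundary (δ (vertices σ))) ⟩
    ⟨ w , coboundary (coboundary (δ (vertices σ))) ⟩
      ≡⟨ ∑-zero w (λ (a , τ) → trans (cong (a ℤ.*_) (coboundary-coboundary (δ (vertices σ)) (vertices τ))) (ℤ.*-zeroʳ a)) ⟩
    0ℤ ∎

  -- Collecting equal terms of a chain

  remove : ∀ {s} → Simplex K s → Chain K s → Chain K s
  remove τ []            = []
  remove τ ((b , υ) ∷ x) with vertices υ ≟ᵛ vertices τ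
  ... | yes _ = remove τ x
  ... | no  _ = (b , υ) ∷ remove τ x

  length-remove : ∀ {s} (τ : Simplex K s) x → length (remove τ x) ℕ.≤ length x
  length-remove τ []            = z≤n
  length-remove τ ((b , υ) ∷ x) with vertices υ ≟ᵛ vertices τ
  ... | yes _ = ℕ.m≤n⇒m≤1+n (length-remove τ x)
  ... | no  _ = s≤s (length-remove τ x)

  pairing-remove : ∀ {s} (τ : Simplex K s) x f →
                   ⟨ x , f ⟩ ≡ coeff K x τ ℤ.* f (vertices τ) ℤ.+ ⟨ remove τ x , f ⟩
  pairing-remove τ []            f = refl
  pairing-remove τ ((b , υ) ∷ x) f with vertices υ ≟ᵛ vertices τ
  ... | yes eq rewrite eq | pairing-remove τ x f = lemma b (coeff K x τ) (f (vertices τ)) _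
    where
    lemma : ∀ b c d e → b ℤ.* d ℤ.+ (c ℤ.* d ℤ.+ e) ≡ (b ℤ.+ c) ℤ.* d ℤ.+ e
    lemma = solve-∀
  ... | no  _  rewrite pairing-remove τ x f = lemma (b ℤ.* f (vertices υ)) (coeff K x τ) (f (vertices τ)) _
    where
    lemma : ∀ b c d e → b ℤ.+ (c ℤ.* d ℤ.+ e) ≡ (0ℤ ℤ.+ c) ℤ.* d ℤ.+ (b ℤ.+ e)
    lemma = solve-∀

  coeff-remove-≡ : ∀ {s} (τ : Simplex K s) x σ → vertices τ ≡ vertices σ → coeff K (remove τ x) σ ≡ 0ℤ
  coeff-remove-≡ τ []            σ eq = refl
  coeff-remove-≡ τ ((b , υ) ∷ x) σ eq with vertices υ ≟ᵛ vertices τ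
  ... | yes _  = coeff-remove-≡ τ x σ eq
  ... | no neq rewrite dec-false (vertices υ ≟ᵛ vertices σ) (λ e → neq (trans e (sym eq)))
                     | coeff-remove-≡ τ x σ eq = refl

  coeff-remove-≢ : ∀ {s} (τ : Simplex K s) x σ → vertices τ ≢ vertices σ →
                   coeff K (remove τ x) σ ≡ coeff K x σ
  coeff-remove-≢ τ []            σ neq = refl
  coeff-remove-≢ τ ((b , υ) ∷ x) σ neq with vertices υ ≟ᵛ vertices τ
  ... | yes eq rewrite dec-false (vertices υ ≟ᵛ vertices σ) (λ e → neq (trans (sym eq) e))
                     | coeff-remove-≢ τ x σ neq = sym (ℤ.+-identityˡ _)
  ... | no  _  = cong (ℤ._+_ (coeff-term K (b , υ) σ)) (coeff-remove-≢ τ x σ neq)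

  -- A chain may list a simplex several times, so single terms need not vanish. All terms on the
  -- first simplex are collected at once: together they contribute its coefficient times the value
  -- of `f`.
  pairing-zero : ∀ {s} (x : Chain K s) f → (∀ τ → coeff K x τ ℤ.* f (vertices τ) ≡ 0ℤ) → ⟨ x , f ⟩ ≡ 0ℤ
  pairing-zero x f = go (length x) x ℕ.≤-refl
    where
    -- The recursion is on `remove τ x₀`, which is not a subterm, hence the bound `n` on the length.
    go : ∀ n x → length x ℕ.≤ n → (∀ τ → coeff K x τ ℤ.* f (vertices τ) ≡ 0ℤ) → ⟨ x , f ⟩ ≡ 0ℤ
    go n       []               len  zer = refl
    go (suc n) x₀@((a , τ) ∷ x) len zer =
      trans (pairing-remove τ x₀ f) (cong₂ ℤ._+_ (zer τ) (go n (remove τ x₀) shorter zer′))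
      where
      shorter : length (remove τ x₀) ℕ.≤ n
      shorter with vertices τ ≟ᵛ vertices τ
      ... | yes _ = ℕ.≤-trans (length-remove τ x) (ℕ.s≤s⁻¹ len)
      ... | no ne = contradiction refl ne
      zer′ : ∀ υ → coeff K (remove τ x₀) υ ℤ.* f (vertices υ) ≡ 0ℤ
      zer′ υ with vertices τ ≟ᵛ vertices υ
      ... | yes eq = cong (ℤ._* f (vertices υ)) (coeff-remove-≡ τ x₀ υ eq)
      ... | no neq = trans (cong (ℤ._* f (vertices υ)) (coeff-remove-≢ τ x₀ υ neq)) (zer υ)

  -- The face of `ω` opposite its vertex `q` has coefficient 0 in `∂ y`. Of all its cofaces only `ω`
  -- can have a nonzero coefficient in `y`, so this 0 is, up to sign, the coefficient of `ω`.
  coface-coeff-zero : ∀ {s} (y : Chain K (suc s)) → _≈ᶜ_ K (∂ K y) [] →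
    ∀ ω q → (∀ τ p → removeAt (vertices τ) p ≡ removeAt (vertices ω) q →
                     vertices τ ≢ vertices ω → coeff K y τ ≡ 0ℤ) →
    coeff K y ω ≡ 0ℤ
  coface-coeff-zero y ∂y≈0 ω q others = sign-cancel (toℕ q) (begin
    ε ℤ.* coeff K y ω
      ≡⟨ rearrange ε (coeff K y ω) 0ℤ ⟩
    0ℤ ℤ.- (0ℤ ℤ.+ ℤ.- ε ℤ.* coeff K y ω)
      ≡⟨ cong₂ (λ a b → 0ℤ ℤ.- (a ℤ.+ ℤ.- ε ℤ.* b)) (sym (trans (sym (coeff-∂ y c)) (∂y≈0 c))) (coeff-pairing y ω) ⟩
    0ℤ ℤ.- (⟨ y , incidence (vertices c) ⟩ ℤ.+ ℤ.- ε ℤ.* ⟨ y , δ (vertices ω) ⟩)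
      ≡⟨ cong (ℤ._-_ 0ℤ) (split y) ⟩
    0ℤ ℤ.- ⟨ y , f ⟩
      ≡⟨ cong (ℤ._-_ 0ℤ) (pairing-zero y f zer) ⟩
    0ℤ ∎)
    where
    c = omit K ω q
    ε = sign (toℕ q)
    -- Subtracting `ε` times the indicator of `ω` makes the cochain vanish at `ω` itself; wherever
    -- else it is nonzero, `others` applies.
    f : Vec Vertex _ → ℤ
    f u = incidence (vertices c) u ℤ.+ ℤ.- ε ℤ.* δ (vertices ω) u
    rearrange : ∀ e k z → e ℤ.* k ≡ 0ℤ ℤ.- (0ℤ ℤ.+ ℤ.- e ℤ.* k)
    rearrange = solve-∀
    split : ∀ y → ⟨ y , incidence (vertices c) ⟩ ℤ.+ ℤ.- ε ℤ.* ⟨ y , δ (vertices ω) ⟩ ≡ ⟨ y , f ⟩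
    split y = begin
      ⟨ y , incidence (vertices c) ⟩ ℤ.+ ℤ.- ε ℤ.* ⟨ y , δ (vertices ω) ⟩
        ≡⟨ cong (ℤ._+_ (⟨ y , incidence (vertices c) ⟩)) (∑-*ˡ (ℤ.- ε) y _) ⟨
      _ ≡⟨ ∑-+ y _ _ ⟨
      _ ≡⟨ ∑-cong y (λ (a , τ) → lemma a _ (ℤ.- ε) _) ⟩
      ⟨ y , f ⟩ ∎
      where
      lemma : ∀ a b e d → a ℤ.* b ℤ.+ e ℤ.* (a ℤ.* d) ≡ a ℤ.* (b ℤ.+ e ℤ.* d)
      lemma = solve-∀
    f-ω : ∀ {u} → u ≡ vertices ω → f u ≡ 0ℤ
    f-ω refl = trans
      (cong₂ (λ a b → a ℤ.+ ℤ.- ε ℤ.* b)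
        (trans (incidence-single {c = vertices c} {vertices ω} q
                 (λ i i≢q eq → lookup-∉-removeAt (vertices ω) q (sorted ω)
                   (subst (λ r → lookup (vertices ω) q ∈ toList r) eq
                     (lookup-∈-removeAt (vertices ω) q i i≢q))))
               (cong (ε ℤ.*_) (δ-≡ {c = vertices c} refl)))
        (δ-≡ {c = vertices ω} refl))
      (lemma ε)
      where
      lemma : ∀ e → e ℤ.* 1ℤ ℤ.+ ℤ.- e ℤ.* 1ℤ ≡ 0ℤ
      lemma = solve-∀
    f-other : ∀ {u} → u ≢ vertices ω → (∀ i → removeAt u i ≢ vertices c) → f u ≡ 0ℤ
    f-other {u} neq none = trans
      (cong₂ (λ a b → a ℤ.+ ℤ.- ε ℤ.* b) (incidence-zero {c = vertices c} {u} none) (δ-≢ neq))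
      (trans (ℤ.+-identityˡ _) (ℤ.*-zeroʳ (ℤ.- ε)))
    cases : ∀ τ → Dec (vertices τ ≡ vertices ω) → Dec (∃ λ p → removeAt (vertices τ) p ≡ vertices c) →
            coeff K y τ ℤ.* f (vertices τ) ≡ 0ℤ
    cases τ (yes eq) _              = trans (cong (coeff K y τ ℤ.*_) (f-ω eq)) (ℤ.*-zeroʳ (coeff K y τ))
    cases τ (no neq) (yes (p , eq)) = cong (ℤ._* f (vertices τ)) (others τ p eq neq)
    cases τ (no neq) (no none)      =
      trans (cong (coeff K y τ ℤ.*_) (f-other neq (λ i eq → none (i , eq)))) (ℤ.*-zeroʳ (coeff K y τ))
    zer : ∀ τ → coeff K y τ ℤ.* f (vertices τ) ≡ 0ℤ
    zer τ = cases τ (vertices τ ≟ᵛ vertices ω) (Fin.any? (λ p → removeAt (vertices τ) p ≟ᵛ vertices c))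

  -- Vertex `q` of `τ` is not in the common facet, so if `σ` contains it, it must be the vertex that
  -- `σ` adds to that facet.
  removeAt-ext : ∀ {s} (σ τ : Simplex K (suc s)) p q → removeAt (vertices σ) p ≡ removeAt (vertices τ) q →
                 lookup (vertices τ) q ∈ toList (vertices σ) → vertices σ ≡ vertices τ
  removeAt-ext σ τ p q eq v∈σ with ∈⇒lookup⊎removeAt (vertices σ) p v∈σ
  ... | inj₂ v∈ = contradiction (subst (λ r → lookup (vertices τ) q ∈ toList r) eq v∈)
                                (lookup-∉-removeAt (vertices τ) q (sorted τ))
  ... | inj₁ v≡ = sorted-ext (sorted σ) (sorted τ)
                    (half σ τ p q eq (sym v≡)) (half τ σ q p (sym eq) v≡)
    where
    half : ∀ (σ τ : Simplex K _) p q → removeAt (vertices σ) p ≡ removeAt (vertices τ) q →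
           lookup (vertices σ) p ≡ lookup (vertices τ) q → toList (vertices σ) ⊆ toList (vertices τ)
    half σ τ p q eq v≡ x∈ with ∈⇒lookup⊎removeAt (vertices σ) p x∈
    ... | inj₁ refl = subst (_∈ toList (vertices τ)) (sym v≡) (lookup-∈ (vertices τ) q)
    ... | inj₂ x∈′  = removeAt-⊆ (vertices τ) q (subst (λ r → _ ∈ toList r) eq x∈′)

  -- Cofaces and the elimination of simplices from chains

  record Coface {s} (τ : Simplex K s) (v : Vertex) : Set where
    field
      coface   : Simplex K (suc s)
      position : Fin (suc s)
      omit-≡   : removeAt (vertices coface) position ≡ vertices τ
      lookup-≡ : lookup (vertices coface) position ≡ v

    ⊆-coface : toList (vertices coface) ⊆ v ∷ toList (vertices τ)
    ⊆-coface x∈ with ∈⇒lookup⊎removeAt (vertices coface) position x∈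
    ... | inj₁ eq  = here (trans eq lookup-≡)
    ... | inj₂ x∈′ = there (subst (λ r → _ ∈ toList r) omit-≡ x∈′)

    apex-∈ : ∀ q → q ≢ position → v ∈ toList (removeAt (vertices coface) q)
    apex-∈ q q≢ = subst (_∈ _) lookup-≡ (lookup-∈-removeAt (vertices coface) position q q≢)

  cone : ∀ {s} (τ : Simplex K s) v → v ∉ toList (vertices τ) → IsFace (v ∷ toList (vertices τ)) → Coface τ v
  cone τ v v∉τ face with p , srt ← insertion (vertices τ) v (sorted τ) v∉τ = record
    { coface   = simplex (insertAt (vertices τ) p v) srt (⊆-closed ⊆v∷τ face)
    ; position = p
    ; omit-≡   = Vec.removeAt-insertAt (vertices τ) p v
    ; lookup-≡ = Vec.insertAt-lookup (vertices τ) p v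
    }
    where
    ⊆v∷τ : toList (insertAt (vertices τ) p v) ⊆ v ∷ toList (vertices τ)
    ⊆v∷τ x∈ with ∈⇒lookup⊎removeAt (insertAt (vertices τ) p v) p x∈
    ... | inj₁ eq  = here (trans eq (Vec.insertAt-lookup (vertices τ) p v))
    ... | inj₂ x∈′ = there (subst (λ r → _ ∈ toList r) (Vec.removeAt-insertAt (vertices τ) p v) x∈′)

  -- A matching as in discrete Morse theory: every simplex `τ` in `U` is paired with a coface whose
  -- only face in `U` is `τ`. Adding multiples of the boundaries of these cofaces therefore clears
  -- the coefficients on `U` independently of each other.
  module Elimination {s : ℕ} (U : Vec Vertex s → Set) (U? : Decidable U)
    (apex : ∀ τ → U (vertices τ) → Vertex)
    (coface : ∀ τ (u : U (vertices τ)) → Coface τ (apex τ u))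
    (only : ∀ τ (u : U (vertices τ)) q → q ≢ Coface.position (coface τ u) →
            ¬ U (removeAt (vertices (Coface.coface (coface τ u))) q))
    where

    correct : ℤ → ∀ τ → Dec (U (vertices τ)) → Chain K (suc s)
    -- The face `τ` occurs in the boundary of its coface with the sign of its position; that sign
    -- squares to 1, so this multiple contributes exactly `- a` at `τ`.
    correct a τ (yes u) = [ ℤ.- a ℤ.* sign (toℕ (Coface.position (coface τ u))) , Coface.coface (coface τ u) ]
    correct a τ (no _)  = []

    correction-term : ℤ × Simplex K s → Chain K (suc s)
    correction-term (a , τ) = correct a τ (U? (vertices τ))

    correction : Chain K s → Chain K (suc s)
    correction = List.concatMap correction-term

    eliminate : Chain K s → Chain K s
    eliminate z = z ++ ∂ K (correction z)

    eliminate-∷ : ∀ a τ z ω → coeff K (eliminate ((a , τ) ∷ z)) ω ≡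
      (a ℤ.* δ (vertices ω) (vertices τ) ℤ.+ ⟨ correction-term (a , τ) , incidence (vertices ω) ⟩)
        ℤ.+ coeff K (eliminate z) ω
    eliminate-∷ a τ z ω = begin
      coeff K (eliminate (t ∷ z)) ω
        ≡⟨ coeff-eliminate (t ∷ z) ⟩
      coeff-term K t ω ℤ.+ coeff K z ω ℤ.+ ⟨ correction (t ∷ z) , incidence (vertices ω) ⟩
        ≡⟨ cong₂ (λ b c → b ℤ.+ coeff K z ω ℤ.+ c) (coeff-term-δ a τ ω) (∑-++ (correction-term t) (correction z) (weight (incidence (vertices ω)))) ⟩
      a ℤ.* δ (vertices ω) (vertices τ) ℤ.+ coeff K z ω ℤ.+
        (⟨ correction-term t , incidence (vertices ω) ⟩ ℤ.+ ⟨ correction z , incidence (vertices ω) ⟩)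
        ≡⟨ lemma (a ℤ.* δ (vertices ω) (vertices τ)) (coeff K z ω) ⟨ correction-term t , incidence (vertices ω) ⟩ _ ⟩
      _ ≡⟨ cong (ℤ._+_ (a ℤ.* δ (vertices ω) (vertices τ) ℤ.+ ⟨ correction-term t , incidence (vertices ω) ⟩))
             (coeff-eliminate z) ⟨
      _ ∎
      where
      t = a , τ
      coeff-eliminate : ∀ z → coeff K (eliminate z) ω ≡
                        coeff K z ω ℤ.+ ⟨ correction z , incidence (vertices ω) ⟩
      coeff-eliminate z = trans (coeff-++ K z (∂ K (correction z)) ω)
                                (cong (ℤ._+_ (coeff K z ω)) (coeff-∂ (correction z) ω))
      lemma : ∀ a b c d → (a ℤ.+ b) ℤ.+ (c ℤ.+ d) ≡ (a ℤ.+ c) ℤ.+ (b ℤ.+ d)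
      lemma = solve-∀

    -- Term by term: of the faces of the coface of `τ` only `τ` lies in `U`, so at `ω` the boundary
    -- of the correction cancels the term of `τ`, or both are zero.
    eliminated : ∀ z ω → U (vertices ω) → coeff K (eliminate z) ω ≡ 0ℤ
    eliminated []            ω uω = refl
    eliminated ((a , τ) ∷ z) ω uω =
      trans (eliminate-∷ a τ z ω) (cong₂ ℤ._+_ (head (U? (vertices τ))) (eliminated z ω uω))
      where
      d = δ (vertices ω) (vertices τ)
      head : ∀ u? → a ℤ.* d ℤ.+ ⟨ correct a τ u? , incidence (vertices ω) ⟩ ≡ 0ℤ
      head (no ¬u) = trans (ℤ.+-identityʳ _)
        (trans (cong (a ℤ.*_) (δ-≢ (λ eq → ¬u (subst U (sym eq) uω)))) (ℤ.*-zeroʳ a))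
      head (yes u) = begin
        a ℤ.* d ℤ.+ (ℤ.- a ℤ.* e ℤ.* incidence (vertices ω) (vertices C.coface) ℤ.+ 0ℤ)
          ≡⟨ cong (λ b → a ℤ.* d ℤ.+ (ℤ.- a ℤ.* e ℤ.* b ℤ.+ 0ℤ))
               (trans (incidence-single C.position (λ i i≢p eq → only τ u i i≢p (subst U (sym eq) uω)))
                      (cong (λ b → e ℤ.* δ (vertices ω) b) C.omit-≡)) ⟩
        a ℤ.* d ℤ.+ (ℤ.- a ℤ.* e ℤ.* (e ℤ.* d) ℤ.+ 0ℤ)
          ≡⟨ lemma a e d ⟩
        (a ℤ.+ ℤ.- a ℤ.* (e ℤ.* e)) ℤ.* d
          ≡⟨ cong (λ b → (a ℤ.+ ℤ.- a ℤ.* b) ℤ.* d) (sign-square (toℕ C.position)) ⟩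
        (a ℤ.+ ℤ.- a ℤ.* 1ℤ) ℤ.* d
          ≡⟨ lemma′ a d ⟩
        0ℤ ∎
        where
        module C = Coface (coface τ u)
        e = sign (toℕ C.position)
        lemma : ∀ a e d → a ℤ.* d ℤ.+ (ℤ.- a ℤ.* e ℤ.* (e ℤ.* d) ℤ.+ 0ℤ) ≡ (a ℤ.+ ℤ.- a ℤ.* (e ℤ.* e)) ℤ.* d
        lemma = solve-∀
        lemma′ : ∀ a d → (a ℤ.+ ℤ.- a ℤ.* 1ℤ) ℤ.* d ≡ 0ℤ
        lemma′ = solve-∀

    unaffected : ∀ z ω → (∀ τ u q → removeAt (vertices (Coface.coface (coface τ u))) q ≢ vertices ω) →
                 coeff K (eliminate z) ω ≡ coeff K z ω
    unaffected []            ω not = refl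
    unaffected ((a , τ) ∷ z) ω not = trans (eliminate-∷ a τ z ω)
      (cong₂ ℤ._+_
        (trans (cong₂ ℤ._+_ (sym (coeff-term-δ a τ ω)) (head (U? (vertices τ)))) (ℤ.+-identityʳ (coeff-term K (a , τ) ω)))
        (unaffected z ω not))
      where
      head : ∀ u? → ⟨ correct a τ u? , incidence (vertices ω) ⟩ ≡ 0ℤ
      head (no _)  = refl
      head (yes u) = trans (ℤ.+-identityʳ _)
        (trans (cong (λ b → ℤ.- a ℤ.* sign (toℕ (Coface.position (coface τ u))) ℤ.* b) (incidence-zero (not τ u)))
               (ℤ.*-zeroʳ (ℤ.- a ℤ.* sign (toℕ (Coface.position (coface τ u))))))

-- Permutations indexed by Fin (n !)

-- The Lehmer code: the leading digit of `k` in the factorial number system is the first value, and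
-- `punchIn` renumbers the remaining values so as to skip it.
perm : ∀ n → Fin (n !) → Vec (Fin n) n
perm zero    _ = []
perm (suc n) k with h , l ← remQuot {suc n} (n !) k = h ∷ Vec.map (punchIn h) (perm n l)

lookup-perm-injective : ∀ n (k : Fin (n !)) i j → lookup (perm n k) i ≡ lookup (perm n k) j → i ≡ j
lookup-perm-injective (suc n) k zero    zero    eq = refl
lookup-perm-injective (suc n) k zero    (suc j) eq =
  contradiction (sym (trans eq (Vec.lookup-map j _ (perm n _)))) (Fin.punchInᵢ≢i _ _)
lookup-perm-injective (suc n) k (suc i) zero    eq =
  contradiction (trans (sym (Vec.lookup-map i _ (perm n _))) eq) (Fin.punchInᵢ≢i _ _)
lookup-perm-injective (suc n) k (suc i) (suc j) eq =
  cong suc (lookup-perm-injective n _ i j (Fin.punchIn-injective _ _ _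
    (trans (sym (Vec.lookup-map i _ (perm n _))) (trans eq (Vec.lookup-map j _ (perm n _))))))

map-punchIn-injective : ∀ {n s} (i : Fin (suc n)) {xs ys : Vec (Fin n) s} →
                        Vec.map (punchIn i) xs ≡ Vec.map (punchIn i) ys → xs ≡ ys
map-punchIn-injective i {[]}     {[]}     eq = refl
map-punchIn-injective i {x ∷ xs} {y ∷ ys} eq =
  cong₂ _∷_ (Fin.punchIn-injective i x y (Vec.∷-injectiveˡ eq)) (map-punchIn-injective i (Vec.∷-injectiveʳ eq))

perm-injective : ∀ n (k l : Fin (n !)) → perm n k ≡ perm n l → k ≡ l
perm-injective zero    zero zero eq = refl
perm-injective (suc n) k l eq = begin
  k                                           ≡⟨ Fin.combine-remQuot {suc n} (n !) k ⟨
  combine (proj₁ (split k)) (proj₂ (split k)) ≡⟨ cong₂ combine heads (perm-injective n _ _ tails) ⟩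
  combine (proj₁ (split l)) (proj₂ (split l)) ≡⟨ Fin.combine-remQuot {suc n} (n !) l ⟩
  l                                           ∎
  where
  split = remQuot {suc n} (n !)
  heads : proj₁ (split k) ≡ proj₁ (split l)
  heads = Vec.∷-injectiveˡ eq
  tails : perm n (proj₂ (split k)) ≡ perm n (proj₂ (split l))
  tails = map-punchIn-injective (proj₁ (split l))
    (trans (cong (λ h → Vec.map (punchIn h) (perm n (proj₂ (split k)))) (sym heads)) (Vec.∷-injectiveʳ eq))

-- The first value is the leading digit. By injectivity it does not recur, so `punchOut` can close
-- the gap it leaves and the recursion codes the rest.
perm-surjective : ∀ n (xs : Vec (Fin n) n) → (∀ i j → lookup xs i ≡ lookup xs j → i ≡ j) →
                  ∃ λ k → perm n k ≡ xs
perm-surjective zero    []       inj = zero , refl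
perm-surjective (suc n) (x ∷ xs) inj = combine x (proj₁ rec) , perm-combine
  where
  avoid : ∀ i → x ≢ lookup xs i
  avoid i eq with () ← inj zero (suc i) eq
  ys : Vec (Fin n) n
  ys = Vec.tabulate λ i → punchOut (avoid i)
  map-ys : Vec.map (punchIn x) ys ≡ xs
  map-ys = begin
    Vec.map (punchIn x) ys                              ≡⟨ Vec.tabulate-∘ (punchIn x) _ ⟨
    Vec.tabulate (λ i → punchIn x (punchOut (avoid i))) ≡⟨ Vec.tabulate-cong (λ i → Fin.punchIn-punchOut (avoid i)) ⟩
    Vec.tabulate (lookup xs)                            ≡⟨ Vec.tabulate∘lookup xs ⟩
    xs                                                  ∎
  rec : ∃ λ k → perm n k ≡ ys
  rec = perm-surjective n ys λ i j eq → Fin.suc-injective (inj (suc i) (suc j)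
    (Fin.punchOut-injective (avoid i) (avoid j)
      (trans (sym (Vec.lookup∘tabulate _ i)) (trans eq (Vec.lookup∘tabulate _ j)))))
  perm-combine : perm (suc n) (combine x (proj₁ rec)) ≡ x ∷ xs
  perm-combine = trans
    (cong (λ (h , l) → h ∷ Vec.map (punchIn h) (perm n l)) (Fin.remQuot-combine {suc n} {n !} x (proj₁ rec)))
    (cong (x ∷_) (trans (cong (Vec.map (punchIn x)) (proj₂ rec)) map-ys))

-- Acyclicity of the star cluster

module _ {m : ℕ} where
  open Square

  square-≡ : {s t : Square m} → col s ≡ col t → row s ≡ row t → s ≡ t
  square-≡ {square _ _ _} {square _ _ _} refl refl = refl

  column≤row : ∀ (s : Square m) → col s Fin.≤ row s
  column≤row (square c r c≤r) = recompute (toℕ c ℕ.≤? toℕ r) c≤r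

  diagonal : Fin m → Square m
  diagonal i = square i i ℕ.≤-refl

  nonAttacking-∷ : ∀ {v : Square m} {p} → NonAttacking p →
                   (∀ {t} → t ∈ p → v ≢ t → col v ≢ col t × row v ≢ row t) → NonAttacking (v ∷ p)
  nonAttacking-∷ na v# (here refl) (here refl) s≢t = contradiction refl s≢t
  nonAttacking-∷ na v# (here refl) (there t∈)  s≢t = v# t∈ s≢t
  nonAttacking-∷ na v# (there s∈)  (here refl) s≢t with c , r ← v# s∈ (s≢t ∘ sym) = c ∘ sym , r ∘ sym
  nonAttacking-∷ na v# (there s∈)  (there t∈)  s≢t = na s∈ t∈ s≢t

  -- The two implications together say that `s` is (i,i) or has `i` as neither coordinate.
  Respects : Fin m → Square m → Set
  Respects i s = (col s ≡ i → row s ≡ i) × (row s ≡ i → col s ≡ i)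

  respects? : ∀ i s → Dec (Respects i s)
  respects? i s = ((col s Fin.≟ i) →-dec (row s Fin.≟ i)) ×-dec ((row s Fin.≟ i) →-dec (col s Fin.≟ i))

  -- The vertex (i,i) of the reference simplex {(1,1),…,(m,m)} spans a face
  -- together with the simplex xs.
  Free : ∀ {s} → Fin m → Vec (Square m) s → Set
  Free i = All (Respects i)

  free? : ∀ {s} i (xs : Vec (Square m) s) → Dec (Free i xs)
  free? i = All.all? (respects? i)

  -- Joining diagonal squares to a simplex thus never costs it a free index.
  diagonal-respects : ∀ i j → Respects i (diagonal j)
  diagonal-respects i j = (λ eq → eq) , (λ eq → eq)

  ⊆-free : ∀ {s t i} {xs : Vec (Square m) s} {ys : Vec (Square m) t} →
           toList xs ⊆ diagonal i ∷ toList ys → Free i ys → Free i xs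
  ⊆-free {i = i} {xs} ⊆ys free = ∈-All xs λ x∈ → helper (⊆ys x∈)
    where
    helper : ∀ {x} → x ∈ diagonal i ∷ _ → Respects i x
    helper (here refl) = diagonal-respects i i
    helper (there x∈)  = All-∈ free x∈

  free-face : ∀ {s i} {xs : Vec (Square m) s} → Free i xs → NonAttacking (toList xs) →
              NonAttacking (diagonal i ∷ toList xs)
  free-face {i = i} free na = nonAttacking-∷ na λ t∈ i≢t →
    (λ eq → i≢t (square-≡ eq (sym (proj₁ (All-∈ free t∈) (sym eq))))) ,
    (λ eq → i≢t (square-≡ (sym (proj₂ (All-∈ free t∈) (sym eq))) eq))

  open Simplex

  -- The chain lies in the union of the stars of the first `j` reference vertices; for `j = 0` it is
  -- the zero chain.
  SupportedBelow : ∀ {s} → ℕ → Chain (St m) s → Set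
  SupportedBelow j z = ∀ ω → (∀ i → toℕ i ℕ.< j → ¬ Free i (vertices ω)) → coeff (St m) z ω ≡ 0ℤ

  _∈?_ : ∀ (v : Square m) p → Dec (v ∈ p)
  v ∈? p = any? (SimplicialComplex._≟_ (St m) v) p

  -- One step of a sweep over the stars. The simplices to be cleared are those whose first free
  -- index is `j` and which lack (j,j); each is paired with its join with (j,j), all of whose other
  -- faces contain (j,j).
  module Stage {k : ℕ} (j : Fin m) where

    U : Vec (Square m) (suc k) → Set
    U xs = Free j xs × diagonal j ∉ toList xs × (∀ i → toℕ i ℕ.< toℕ j → ¬ Free i xs)

    U? : Decidable U
    U? xs = free? j xs ×-dec ¬? (diagonal j ∈? toList xs) ×-dec
            Fin.all? (λ i → (toℕ i ℕ.<? toℕ j) →-dec ¬? (free? i xs))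

    coface : ∀ τ → U (vertices τ) → Coface (St m) τ (diagonal j)
    coface τ (free , ∉τ , _) = cone (St m) τ (diagonal j) ∉τ (free-face free (isFace τ))

    open Elimination (St m) U U? (λ _ _ → diagonal j) coface
      (λ τ u q q≢p (_ , ∉ , _) → ∉ (Coface.apex-∈ (coface τ u) q q≢p)) public

    module _ (z : Chain (St m) (suc k)) (∂z≈0 : _≈ᶜ_ (St m) (∂ (St m) z) [])
             (supp : SupportedBelow (suc (toℕ j)) z) where

      ∂eliminate≈0 : _≈ᶜ_ (St m) (∂ (St m) (eliminate z)) []
      ∂eliminate≈0 σ = trans (coeff-∂-++ (St m) z (∂ (St m) (correction z)) σ)
                             (cong₂ ℤ._+_ (∂z≈0 σ) (∂∂≈0 (St m) (correction z) σ))

      -- Every coface used is free at `j`, and so are its faces, so the elimination leaves this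
      -- coefficient alone; it was 0 by the hypothesis on the support.
      not-free : ∀ ω → (∀ i → toℕ i ℕ.< toℕ j → ¬ Free i (vertices ω)) → ¬ Free j (vertices ω) →
                 coeff (St m) (eliminate z) ω ≡ 0ℤ
      not-free ω below ¬free = trans
        (unaffected z ω λ τ u q eq → ¬free (subst (Free j) eq
          (⊆-free (λ x∈ → Coface.⊆-coface (coface τ u) (removeAt-⊆ _ q x∈)) (proj₁ u))))
        (supp ω λ i i≤j free → helper i i≤j free)
        where
        helper : ∀ i → toℕ i ℕ.< suc (toℕ j) → ¬ Free i (vertices ω)
        helper i i≤j free with ℕ.m≤n⇒m<n∨m≡n (ℕ.s≤s⁻¹ i≤j)
        ... | inj₁ i<j = below i i<j free
        ... | inj₂ i≡j = ¬free (subst (λ l → Free l (vertices ω)) (Fin.toℕ-injective i≡j) free)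

      without-apex : ∀ ω → (∀ i → toℕ i ℕ.< toℕ j → ¬ Free i (vertices ω)) →
                     diagonal j ∉ toList (vertices ω) → coeff (St m) (eliminate z) ω ≡ 0ℤ
      without-apex ω below ∉ω with free? j (vertices ω)
      ... | yes free = eliminated z ω (free , ∉ω , below)
      ... | no ¬free = not-free ω below ¬free

      -- Removing (j,j) from `ω` leaves a facet whose other cofaces lack (j,j) and, like `ω`, are
      -- not free below `j`. By `without-apex` only `ω` could have a nonzero coefficient among them.
      with-apex : ∀ ω → (∀ i → toℕ i ℕ.< toℕ j → ¬ Free i (vertices ω)) →
                  ∀ q → lookup (vertices ω) q ≡ diagonal j → coeff (St m) (eliminate z) ω ≡ 0ℤ
      with-apex ω below q v≡ = coface-coeff-zero (St m) (eliminate z) ∂eliminate≈0 ω q λ τ p eq τ≢ω →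
        without-apex τ
          -- If `τ` were free at `i`, so would be the common facet, and with it `ω`, since (j,j)
          -- respects `i`.
          (λ i i<j free → below i i<j (∈-All (vertices ω) λ x∈ →
            respects i (removeAt-All p free) eq (∈⇒lookup⊎removeAt (vertices ω) q x∈)))
          (λ j∈τ → τ≢ω (removeAt-ext (St m) τ ω p q eq (subst (_∈ toList (vertices τ)) (sym v≡) j∈τ)))
        where
        respects : ∀ i {r x} → All (Respects i) r → r ≡ removeAt (vertices ω) q →
                   x ≡ lookup (vertices ω) q ⊎ x ∈ toList (removeAt (vertices ω) q) → Respects i x
        respects i free eq (inj₁ refl) = subst (Respects i) (sym v≡) (diagonal-respects i j)
        respects i free refl (inj₂ x∈) = All-∈ free x∈

      supportedBelow : SupportedBelow (toℕ j) (eliminate z)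
      supportedBelow ω below with diagonal j ∈? toList (vertices ω)
      ... | no ∉ω  = without-apex ω below ∉ω
      ... | yes ∈ω with q , v≡ ← ∈⇒lookup (vertices ω) ∈ω = with-apex ω below q v≡

  -- Each stage pushes the support out of the last remaining star; after all stages the chain is
  -- zero, and the corrections add up to a filling.
  supportedBelow⇒boundary : ∀ {k} j → j ℕ.≤ m → (z : Chain (St m) (suc k)) →
    _≈ᶜ_ (St m) (∂ (St m) z) [] → SupportedBelow j z →
    ∃ λ w → ∀ σ → coeff (St m) z σ ℤ.+ coeff (St m) (∂ (St m) w) σ ≡ 0ℤ
  supportedBelow⇒boundary zero    _   z ∂z≈0 supp = [] , λ σ → trans (ℤ.+-identityʳ _) (supp σ λ _ ())
  supportedBelow⇒boundary (suc j) j<m z ∂z≈0 supp = correction z ++ w , λ σ → begin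
    coeff (St m) z σ ℤ.+ coeff (St m) (∂ (St m) (correction z ++ w)) σ
      ≡⟨ cong (ℤ._+_ (coeff (St m) z σ)) (coeff-∂-++ (St m) (correction z) w σ) ⟩
    coeff (St m) z σ ℤ.+ (coeff (St m) (∂ (St m) (correction z)) σ ℤ.+ coeff (St m) (∂ (St m) w) σ)
      ≡⟨ ℤ.+-assoc (coeff (St m) z σ) _ _ ⟨
    coeff (St m) z σ ℤ.+ coeff (St m) (∂ (St m) (correction z)) σ ℤ.+ coeff (St m) (∂ (St m) w) σ
      ≡⟨ cong (ℤ._+ coeff (St m) (∂ (St m) w) σ) (coeff-++ (St m) z (∂ (St m) (correction z)) σ) ⟨
    coeff (St m) (eliminate z) σ ℤ.+ coeff (St m) (∂ (St m) w) σ
      ≡⟨ proj₂ rec σ ⟩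
    0ℤ ∎
    where
    open Stage (Fin.fromℕ< j<m)
    supp′ : SupportedBelow (suc (toℕ (Fin.fromℕ< j<m))) z
    supp′ = subst (λ l → SupportedBelow (suc l) z) (sym (Fin.toℕ-fromℕ< j<m)) supp
    rec = supportedBelow⇒boundary j (ℕ.<⇒≤ j<m) (eliminate z) (∂eliminate≈0 z ∂z≈0 supp′)
            (subst (λ l → SupportedBelow l (eliminate z)) (Fin.toℕ-fromℕ< j<m)
              (supportedBelow z ∂z≈0 supp′))
    w = proj₁ rec

-- Injections between finite sets

missed⇒< : ∀ {m k} (g : Fin m → Fin k) → (∀ i j → g i ≡ g j → i ≡ j) →
           ∀ y → (∀ i → g i ≢ y) → m ℕ.< k
missed⇒< {m} {k} g g-inj y missed = Fin.injective⇒≤ {f = f} λ {i} {j} → f-inj i j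
  where
  -- Adjoining the missed value `y` extends `g` to an injection of `suc m` points.
  f : Fin (suc m) → Fin k
  f zero    = y
  f (suc i) = g i
  f-inj : ∀ i j → f i ≡ f j → i ≡ j
  f-inj zero    zero    eq = refl
  f-inj zero    (suc j) eq = contradiction (sym eq) (missed j)
  f-inj (suc i) zero    eq = contradiction eq (missed i)
  f-inj (suc i) (suc j) eq = cong suc (g-inj i j eq)

injective⇒surjective : ∀ {n} (g : Fin n → Fin n) → (∀ i j → g i ≡ g j → i ≡ j) → ∀ y → ∃ λ i → g i ≡ y
injective⇒surjective g g-inj y with Fin.any? (λ i → g i Fin.≟ y)
... | yes hit  = hit
... | no  miss = contradiction (missed⇒< g g-inj y (λ i eq → miss (i , eq))) (ℕ.<-irrefl refl)

-- Perfect placements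

module _ {m : ℕ} where
  open Square
  open Simplex

  Perfect : ∀ {s} → Vec (Square m) s → Set
  Perfect xs = ∀ i → ¬ Free i xs

  -- An index that is no coordinate of the placement would be free vacuously.
  perfect-occurs : ∀ {s} {xs : Vec (Square m) s} → Perfect xs →
                   ∀ i → ∃ λ p → col (lookup xs p) ≡ i ⊎ row (lookup xs p) ≡ i
  perfect-occurs {xs = xs} perfect i
    with Fin.any? (λ p → (col (lookup xs p) Fin.≟ i) ⊎-dec (row (lookup xs p) Fin.≟ i))
  ... | yes occurs = occurs
  ... | no  none   = contradiction (∈-All xs λ x∈ → vacuous (∈⇒lookup xs x∈)) (perfect i)
    where
    vacuous : ∀ {x} → (∃ λ p → lookup xs p ≡ x) → Respects i x
    vacuous (p , refl) = (λ eq → contradiction (p , inj₁ eq) none) , (λ eq → contradiction (p , inj₂ eq) none)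

  -- The square (b,a) can then be added. If the placement is perfect, `b` is not a column and hence
  -- a row, and `a` is likewise a column.
  Extendable : ∀ {s} → Vec (Square m) s → Set
  Extendable xs = ∃ λ b → ∃ λ a → b Fin.< a × All (λ s → col s ≢ b × row s ≢ a) xs

  extendable? : ∀ {s} (xs : Vec (Square m) s) → Dec (Extendable xs)
  extendable? xs = Fin.any? λ b → Fin.any? λ a → (b Fin.<? a) ×-dec
    All.all? (λ s → ¬? (col s Fin.≟ b) ×-dec ¬? (row s Fin.≟ a)) xs

  ¬extendable⇒blocked : ∀ {s} {xs : Vec (Square m) s} → ¬ Extendable xs → ∀ b a → b Fin.< a →
                        ∃ λ p → col (lookup xs p) ≡ b ⊎ row (lookup xs p) ≡ a
  ¬extendable⇒blocked {xs = xs} ¬ext b a b<a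
    with Fin.any? (λ p → (col (lookup xs p) Fin.≟ b) ⊎-dec (row (lookup xs p) Fin.≟ a))
  ... | yes blocked = blocked
  ... | no  none    = contradiction (b , a , b<a , ∈-All xs λ x∈ → away (∈⇒lookup xs x∈)) ¬ext
    where
    away : ∀ {x} → (∃ λ p → lookup xs p ≡ x) → col x ≢ b × row x ≢ a
    away (p , refl) = (λ eq → none (p , inj₁ eq)) , (λ eq → none (p , inj₂ eq))

  -- The order is lexicographic, and two rooks in the same column would attack each other, so the
  -- column alone decides.
  columns-ascending : ∀ {s} {xs : Vec (Square m) s} → AllPairs _<ˢ_ xs → NonAttacking (toList xs) →
                      AllPairs (λ s t → col s Fin.< col t) xs
  columns-ascending {xs = []}     []         na = []
  columns-ascending {xs = x ∷ xs} (x< ∷ srt) na =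
    ∈-All xs (λ t∈ → smaller t∈ (All-∈ x< t∈)) ∷ columns-ascending srt (λ s∈ t∈ → na (there s∈) (there t∈))
    where
    smaller : ∀ {t} → t ∈ toList xs → x <ˢ t → col x Fin.< col t
    smaller t∈ (inj₁ c<c)       = c<c
    smaller t∈ (inj₂ (c≡c , r<r)) = contradiction c≡c
      (proj₁ (na (here refl) (there t∈) (λ { refl → ℕ.<-irrefl refl r<r })))

  -- The columns increase and leave no gap from `c` upwards, so they are consecutive; `c` varies for
  -- the sake of the induction.
  initial-columns : ∀ {s} (xs : Vec (Square m) s) c → AllPairs (λ s t → col s Fin.< col t) xs →
    All (λ s → c ℕ.≤ toℕ (col s)) xs →
    (∀ y {t} → t ∈ toList xs → c ℕ.≤ toℕ y → y Fin.≤ col t → ∃ λ u → u ∈ toList xs × col u ≡ y) →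
    ∀ i → toℕ (col (lookup xs i)) ≡ c ℕ.+ toℕ i
  initial-columns (x ∷ xs) c (x< ∷ asc) (c≤x ∷ c≤xs) closed = go
    where
    c<m : c ℕ.< m
    c<m = ℕ.≤-<-trans c≤x (Fin.toℕ<n (col x))
    y = fromℕ< c<m
    y≡c = Fin.toℕ-fromℕ< c<m
    -- Some square has column `c`; it must be the head, since all later columns exceed that of the
    -- head, which is at least `c`.
    col-x : toℕ (col x) ≡ c
    col-x with closed y (here refl) (ℕ.≤-reflexive (sym y≡c)) (subst (ℕ._≤ toℕ (col x)) (sym y≡c) c≤x)
    ... | _ , here refl , eq = trans (cong toℕ eq) y≡c
    ... | _ , there u∈  , eq = contradiction (subst (toℕ (col x) ℕ.<_) (trans (cong toℕ eq) y≡c) (All-∈ x< u∈))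
                                             (ℕ.≤⇒≯ c≤x)
    closed′ : ∀ y {t} → t ∈ toList xs → suc c ℕ.≤ toℕ y → y Fin.≤ col t → ∃ λ u → u ∈ toList xs × col u ≡ y
    closed′ y t∈ c<y y≤t with closed y (there t∈) (ℕ.<⇒≤ c<y) y≤t
    ... | _ , here refl , eq = contradiction (trans (sym col-x) (cong toℕ eq)) (ℕ.<⇒≢ c<y)
    ... | u , there u∈  , eq = u , u∈ , eq
    go : ∀ i → toℕ (col (lookup (x ∷ xs) i)) ≡ c ℕ.+ toℕ i
    go zero    = trans col-x (sym (ℕ.+-identityʳ c))
    go (suc i) = trans (initial-columns xs (suc c) asc
      (∈-All xs λ t∈ → subst (ℕ._< _) col-x (All-∈ x< t∈)) closed′ i) (sym (ℕ.+-suc c (toℕ i)))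

  -- `m` is tied to `n + n` by an equation only, so that it can be instantiated with `2 * n`.
  module Doubled (n : ℕ) (n+n≡m : n ℕ.+ n ≡ m) where

    -- 2n coordinates cover 2n indices, so none is covered twice.
    perfect-disjoint : {xs : Vec (Square m) n} → Perfect xs →
                       ∀ {s t} → s ∈ toList xs → t ∈ toList xs → col s ≢ row t
    perfect-disjoint {xs} perfect s∈ t∈ eq with p , refl ← ∈⇒lookup xs s∈ | q , refl ← ∈⇒lookup xs t∈ =
      ℕ.<-irrefl (sym n+n≡m) (missed⇒< (join n n ∘ proj₁ ∘ occurs) occurs-inj (join n n (proj₁ spare)) missed)
      where
      value : Fin n ⊎ Fin n → Fin m
      value = [ (λ p → col (lookup xs p)) , (λ p → row (lookup xs p)) ]′
      occurs : ∀ i → ∃ λ x → value x ≡ i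
      occurs i with perfect-occurs perfect i
      ... | p , inj₁ eq = inj₁ p , eq
      ... | p , inj₂ eq = inj₂ p , eq
      join-inj : ∀ x y → join n n x ≡ join n n y → x ≡ y
      join-inj x y eq = trans (sym (Fin.splitAt-join n n x)) (trans (cong (splitAt n) eq) (Fin.splitAt-join n n y))
      occurs-inj : ∀ i j → join n n (proj₁ (occurs i)) ≡ join n n (proj₁ (occurs j)) → i ≡ j
      occurs-inj i j eq = trans (sym (proj₂ (occurs i)))
        (trans (cong value (join-inj (proj₁ (occurs i)) (proj₁ (occurs j)) eq)) (proj₂ (occurs j)))
      c = col (lookup xs p)
      -- As `c` is both a column and a row, one of its two slots is not the one chosen by `occurs`.
      spare : ∃ λ x → proj₁ (occurs c) ≢ x × value x ≡ c
      spare with occurs c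
      ... | inj₁ _ , _ = inj₂ q , (λ ()) , sym eq
      ... | inj₂ _ , _ = inj₁ p , (λ ()) , refl
      missed : ∀ i → join n n (proj₁ (occurs i)) ≢ join n n (proj₁ spare)
      missed i eq = proj₁ (proj₂ spare) (trans (cong (proj₁ ∘ occurs) c≡i) i≡)
        where
        i≡ : proj₁ (occurs i) ≡ proj₁ spare
        i≡ = join-inj (proj₁ (occurs i)) (proj₁ spare) eq
        c≡i : c ≡ i
        c≡i = trans (sym (proj₂ (proj₂ spare))) (trans (cong value (sym i≡)) (proj₂ (occurs i)))

    PerfectExtendable : Vec (Square m) n → Set
    PerfectExtendable xs = Perfect xs × Extendable xs

    perfectExtendable? : Decidable PerfectExtendable
    perfectExtendable? xs = Fin.all? (λ i → ¬? (free? i xs)) ×-dec extendable? xs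

    extension : ∀ (τ : Simplex (St m) n) → PerfectExtendable (vertices τ) → Square m
    extension τ (_ , b , a , b<a , _) = square b a (ℕ.<⇒≤ b<a)

    extended : ∀ τ (u : PerfectExtendable (vertices τ)) → Coface (St m) τ (extension τ u)
    extended τ (_ , b , a , b<a , away) = cone (St m) τ (square b a (ℕ.<⇒≤ b<a))
      (λ v∈ → proj₁ (All-∈ away v∈) refl)
      (nonAttacking-∷ (isFace τ) λ t∈ _ → proj₁ (All-∈ away t∈) ∘ sym , proj₂ (All-∈ away t∈) ∘ sym)

    -- The new rook (b,a) shares b with a row and a with a column of τ, and
    -- at least one of these two rooks survives in the face.
    extended-face-¬perfect : ∀ τ u q → q ≢ Coface.position (extended τ u) →
                             ¬ Perfect (removeAt (vertices (Coface.coface (extended τ u))) q)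
    extended-face-¬perfect τ u@(perfect , b , a , b<a , away) q q≢p perfect′
      with perfect-occurs perfect b | perfect-occurs perfect a
    ... | p₁ , inj₁ eq | _            = proj₁ (All-∈ away (lookup-∈ (vertices τ) p₁)) eq
    ... | _            | p₂ , inj₂ eq = proj₂ (All-∈ away (lookup-∈ (vertices τ) p₂)) eq
    ... | p₁ , inj₂ row≡b | p₂ , inj₁ col≡a =
      absurd (survives p₁) (survives p₂)
      where
      module C = Coface (extended τ u)
      ρ = vertices C.coface
      v∈ : square b a (ℕ.<⇒≤ b<a) ∈ toList (removeAt ρ q)
      v∈ = C.apex-∈ q q≢p
      survives : ∀ p → lookup (vertices τ) p ≡ lookup ρ q ⊎ lookup (vertices τ) p ∈ toList (removeAt ρ q)
      survives p = ∈⇒lookup⊎removeAt ρ q (removeAt-⊆ ρ C.position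
        (subst (λ r → lookup (vertices τ) p ∈ toList r) (sym C.omit-≡) (lookup-∈ (vertices τ) p)))
      absurd : lookup (vertices τ) p₁ ≡ lookup ρ q ⊎ lookup (vertices τ) p₁ ∈ toList (removeAt ρ q) →
               lookup (vertices τ) p₂ ≡ lookup ρ q ⊎ lookup (vertices τ) p₂ ∈ toList (removeAt ρ q) → ⊥
      absurd (inj₂ t∈) _ = perfect-disjoint perfect′ v∈ t∈ (sym row≡b)
      absurd _ (inj₂ t∈) = perfect-disjoint perfect′ t∈ v∈ col≡a
      -- If neither rook survives, both are the omitted rook, which then has column `a` and row `b`;
      -- but no square has its column above its row.
      absurd (inj₁ eq₁) (inj₁ eq₂) = ℕ.<⇒≱ b<a
        (subst₂ (λ x y → x Fin.≤ y) col≡a (trans (cong row (trans eq₂ (sym eq₁))) row≡b)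
          (column≤row (lookup (vertices τ) p₂)))

    low high : Fin n → Fin m
    low  i = cast n+n≡m (i ↑ˡ n)
    high i = cast n+n≡m (n ↑ʳ i)

    toℕ-low : ∀ i → toℕ (low i) ≡ toℕ i
    toℕ-low i = trans (Fin.toℕ-cast n+n≡m (i ↑ˡ n)) (Fin.toℕ-↑ˡ i n)

    toℕ-high : ∀ i → toℕ (high i) ≡ n ℕ.+ toℕ i
    toℕ-high i = trans (Fin.toℕ-cast n+n≡m (n ↑ʳ i)) (Fin.toℕ-↑ʳ n i)

    low<high : ∀ i j → low i Fin.< high j
    low<high i j = subst₂ ℕ._<_ (sym (toℕ-low i)) (sym (toℕ-high j)) (ℕ.<-≤-trans (Fin.toℕ<n i) (ℕ.m≤m+n n (toℕ j)))

    low-injective : ∀ i j → low i ≡ low j → i ≡ j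
    low-injective i j eq = Fin.toℕ-injective (trans (sym (toℕ-low i)) (trans (cong toℕ eq) (toℕ-low j)))

    high-injective : ∀ i j → high i ≡ high j → i ≡ j
    high-injective i j eq = Fin.toℕ-injective (ℕ.+-cancelˡ-≡ n _ _
      (trans (sym (toℕ-high i)) (trans (cong toℕ eq) (toℕ-high j))))

    split-index : ∀ (x : Fin m) → (∃ λ i → low i ≡ x) ⊎ (∃ λ i → high i ≡ x)
    split-index x with ℕ.<-≤-connex (toℕ x) n
    ... | inj₁ x<n = inj₁ (fromℕ< x<n , Fin.toℕ-injective (trans (toℕ-low _) (Fin.toℕ-fromℕ< x<n)))
    ... | inj₂ n≤x = inj₂ (fromℕ< x∸n<n , Fin.toℕ-injective (trans (toℕ-high _)
                       (trans (cong (n ℕ.+_) (Fin.toℕ-fromℕ< x∸n<n)) (ℕ.m+[n∸m]≡n n≤x))))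
      where
      x∸n<n : toℕ x ∸ n ℕ.< n
      x∸n<n = subst (toℕ x ∸ n ℕ.<_) (ℕ.m+n∸n≡m n n)
        (ℕ.∸-monoˡ-< (subst (toℕ x ℕ.<_) (sym n+n≡m) (Fin.toℕ<n x)) n≤x)

    -- Antipodal vertices of a cross-polytope: both lie in column `low i`, so a choice never changes
    -- the order of the vertices.
    cell : Bool → Fin n → Fin n → Square m
    cell true  i j = square (low i) (high j) (ℕ.<⇒≤ (low<high i j))
    cell false i j = diagonal (low i)

    cells : Vec (Fin n) n → Vec Bool n → Vec (Square m) n
    cells π e = Vec.tabulate λ i → cell (lookup e i) i (lookup π i)

    facet : Vec (Fin n) n → Vec (Square m) n
    facet π = cells π (Vec.replicate n true)

    lookup-facet : ∀ π i → lookup (facet π) i ≡ cell true i (lookup π i)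
    lookup-facet π i = trans (Vec.lookup∘tabulate _ i)
      (cong (λ b → cell b i (lookup π i)) (Vec.lookup-replicate i true))

    -- All columns turn out to lie below all rows, so the columns are the lower half in increasing
    -- order and the rows list the upper half in the order of a permutation.
    perfect-¬extendable⇒facet : ∀ (ω : Simplex (St m) n) → Perfect (vertices ω) → ¬ Extendable (vertices ω) →
                                ∃ λ k → vertices ω ≡ facet (perm n k)
    perfect-¬extendable⇒facet ω perfect ¬ext = proj₁ perm-π ,
      trans ω≡facet (cong facet (sym (proj₂ perm-π)))
      where
      xs = vertices ω
      disjoint : ∀ {s t} → s ∈ toList xs → t ∈ toList xs → col s ≢ row t
      disjoint = perfect-disjoint perfect
      col<row : ∀ {s t} → s ∈ toList xs → t ∈ toList xs → col s Fin.< row t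
      col<row {s} {t} s∈ t∈ with Fin.<-cmp (col s) (row t)
      ... | tri< lt _ _ = lt
      ... | tri≈ _ eq _ = contradiction eq (disjoint s∈ t∈)
      -- A row of `t` below the column of `s` would leave room for a new rook unless `row t` is a
      -- column or `col s` is a row; disjointness excludes both.
      ... | tri> _ _ gt with ¬extendable⇒blocked ¬ext (row t) (col s) gt
      ...   | p , inj₁ eq = contradiction eq (disjoint (lookup-∈ xs p) t∈)
      ...   | p , inj₂ eq = contradiction (sym eq) (disjoint s∈ (lookup-∈ xs p))
      -- An index at or below some column is not a row, hence by perfection it is a column.
      closed : ∀ y {t} → t ∈ toList xs → 0 ℕ.≤ toℕ y → y Fin.≤ col t → ∃ λ u → u ∈ toList xs × col u ≡ y
      closed y t∈ _ y≤t with perfect-occurs perfect y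
      ... | p , inj₁ eq   = lookup xs p , lookup-∈ xs p , eq
      ... | p , inj₂ refl = contradiction (col<row t∈ (lookup-∈ xs p)) (ℕ.≤⇒≯ y≤t)
      col≡ : ∀ i → toℕ (col (lookup xs i)) ≡ toℕ i
      col≡ = initial-columns xs 0 (columns-ascending (sorted ω) (isFace ω)) (∈-All xs λ _ → z≤n) closed
      col≡low : ∀ i → col (lookup xs i) ≡ low i
      col≡low i = Fin.toℕ-injective (trans (col≡ i) (sym (toℕ-low i)))
      row-high : ∀ i → ∃ λ j → high j ≡ row (lookup xs i)
      row-high i with split-index (row (lookup xs i))
      ... | inj₂ is-high = is-high
      -- An index of the lower half is a column already, so it cannot be a row.
      ... | inj₁ (j , eq) = contradiction (trans (col≡low j) eq) (disjoint (lookup-∈ xs j) (lookup-∈ xs i))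
      π : Vec (Fin n) n
      π = Vec.tabulate (proj₁ ∘ row-high)
      π-injective : ∀ i j → lookup π i ≡ lookup π j → i ≡ j
      π-injective i j eq with i Fin.≟ j
      ... | yes i≡j = i≡j
      ... | no  i≢j = contradiction
        (trans (sym (proj₂ (row-high i))) (trans (cong high same) (proj₂ (row-high j))))
        (proj₂ (isFace ω (lookup-∈ xs i) (lookup-∈ xs j)
          λ s≡t → i≢j (low-injective i j (trans (sym (col≡low i)) (trans (cong col s≡t) (col≡low j))))))
        where
        same : proj₁ (row-high i) ≡ proj₁ (row-high j)
        same = trans (sym (Vec.lookup∘tabulate _ i)) (trans eq (Vec.lookup∘tabulate _ j))
      perm-π : ∃ λ k → perm n k ≡ π
      perm-π = perm-surjective n π π-injective
      ω≡facet : xs ≡ facet π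
      ω≡facet = trans (sym (Vec.tabulate∘lookup xs)) (trans
        (Vec.tabulate-cong λ i → trans
          (square-≡ (col≡low i) (trans (sym (proj₂ (row-high i))) (cong high (sym (Vec.lookup∘tabulate _ i)))))
          (sym (lookup-facet π i)))
        (Vec.tabulate∘lookup (facet π)))

    -- A further rook would have to avoid all low columns and, as the permutation is onto, all high
    -- rows; a high column with a low row contradicts column ≤ row.
    facet-maximal : ∀ k (ρ : Simplex (St m) (suc n)) q → removeAt (vertices ρ) q ≢ facet (perm n k)
    facet-maximal k ρ q eq = outside (split-index (col t)) (split-index (row t))
      where
      t = lookup (vertices ρ) q
      π = perm n k
      away : ∀ i → col t ≢ low i × row t ≢ high (lookup π i)
      away i = subst (λ s → col t ≢ col s × row t ≢ row s) (lookup-facet π i)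
        (isFace ρ (lookup-∈ (vertices ρ) q) (removeAt-⊆ (vertices ρ) q s∈)
          λ t≡s → Sorted.lookup-∉-removeAt <ˢ-isStrictTotalOrder (vertices ρ) q (sorted ρ) (subst (_∈ _) (sym t≡s) s∈))
        where
        s∈ : lookup (facet π) i ∈ toList (removeAt (vertices ρ) q)
        s∈ = subst (λ r → lookup (facet π) i ∈ toList r) (sym eq) (lookup-∈ (facet π) i)
      outside : (∃ λ i → low i ≡ col t) ⊎ (∃ λ i → high i ≡ col t) →
              (∃ λ i → low i ≡ row t) ⊎ (∃ λ i → high i ≡ row t) → ⊥
      outside (inj₁ (i , eq)) _ = proj₁ (away i) (sym eq)
      outside (inj₂ _) (inj₂ (j , eq)) with i , refl ← injective⇒surjective (lookup π) (lookup-perm-injective n k) j =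
        proj₂ (away i) (sym eq)
      outside (inj₂ (i , high≡)) (inj₁ (j , low≡)) = ℕ.<⇒≱ (low<high j i)
        (subst₂ Fin._≤_ (sym high≡) (sym low≡) (column≤row t))

-- Cross-polytopes

boolVecs : ∀ n → List (Vec Bool n)
boolVecs zero    = [ [] ]
boolVecs (suc n) = List.map (true ∷_) (boolVecs n) ++ List.map (false ∷_) (boolVecs n)

∑-boolVecs : ∀ n (f : Vec Bool (suc n) → ℤ) →
             ∑ (boolVecs (suc n)) f ≡ ∑ (boolVecs n) (f ∘ (true ∷_)) ℤ.+ ∑ (boolVecs n) (f ∘ (false ∷_))
∑-boolVecs n f = trans (∑-++ (List.map (true ∷_) (boolVecs n)) _ f)
  (cong₂ ℤ._+_ (∑-map (true ∷_) (boolVecs n) f) (∑-map (false ∷_) (boolVecs n) f))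

∑-boolVecs-single : ∀ n (f : Vec Bool n → ℤ) → (∀ e → e ≢ Vec.replicate n true → f e ≡ 0ℤ) →
                    ∑ (boolVecs n) f ≡ f (Vec.replicate n true)
∑-boolVecs-single zero    f off = ℤ.+-identityʳ (f [])
∑-boolVecs-single (suc n) f off = trans (∑-boolVecs n f) (trans
  (cong₂ ℤ._+_
    (∑-boolVecs-single n (f ∘ (true ∷_)) (λ e e≢ → off (true ∷ e) (e≢ ∘ Vec.∷-injectiveʳ)))
    (∑-zero (boolVecs n) (λ e → off (false ∷ e) λ ())))
  (ℤ.+-identityʳ _))

-- Flipping bit `i` pairs off terms of opposite sign; recursion on `i` strips the bits in front of
-- it.
∑-boolVecs-alternating : ∀ n (f : Vec Bool n → ℤ) i → (∀ e → f (Vec.updateAt e i not) ≡ ℤ.- f e) →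
                         ∑ (boolVecs n) f ≡ 0ℤ
∑-boolVecs-alternating (suc n) f zero    alt = begin
  ∑ (boolVecs (suc n)) f
    ≡⟨ ∑-boolVecs n f ⟩
  ∑ (boolVecs n) (f ∘ (true ∷_)) ℤ.+ ∑ (boolVecs n) (f ∘ (false ∷_))
    ≡⟨ ∑-+ (boolVecs n) (f ∘ (true ∷_)) (f ∘ (false ∷_)) ⟨
  ∑ (boolVecs n) (λ e → f (true ∷ e) ℤ.+ f (false ∷ e))
    ≡⟨ ∑-zero (boolVecs n) (λ e → trans (cong (ℤ._+_ (f (true ∷ e))) (alt (true ∷ e))) (ℤ.+-inverseʳ (f (true ∷ e)))) ⟩
  0ℤ ∎
∑-boolVecs-alternating (suc n) f (suc i) alt = trans (∑-boolVecs n f) (cong₂ ℤ._+_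
  (∑-boolVecs-alternating n (f ∘ (true ∷_)) i (λ e → alt (true ∷ e)))
  (∑-boolVecs-alternating n (f ∘ (false ∷_)) i (λ e → alt (false ∷ e))))

-- The orientation sign: -1 to the number of diagonal choices, so that the simplex of off-diagonal
-- rooks gets +1.
parity : ∀ {n} → Vec Bool n → ℤ
parity []          = 1ℤ
parity (true ∷ e)  = parity e
parity (false ∷ e) = ℤ.- parity e

parity-true : ∀ n → parity (Vec.replicate n true) ≡ 1ℤ
parity-true zero    = refl
parity-true (suc n) = parity-true n

parity-flip : ∀ {n} (e : Vec Bool n) i → parity (Vec.updateAt e i not) ≡ ℤ.- parity e
parity-flip (true ∷ e)  zero    = refl
parity-flip (false ∷ e) zero    = sym (ℤ.neg-involutive (parity e))
parity-flip (true ∷ e)  (suc i) = parity-flip e i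
parity-flip (false ∷ e) (suc i) = cong ℤ.-_ (parity-flip e i)

module _ {A : Set} where

  removeAt-tabulate-cong : ∀ {s} {f g : Fin (suc s) → A} i → (∀ j → j ≢ i → f j ≡ g j) →
                           removeAt (Vec.tabulate f) i ≡ removeAt (Vec.tabulate g) i
  removeAt-tabulate-cong         zero    eq = Vec.tabulate-cong (λ j → eq (suc j) λ ())
  removeAt-tabulate-cong {suc s} (suc i) eq =
    cong₂ _∷_ (eq zero λ ()) (removeAt-tabulate-cong i (λ j j≢i → eq (suc j) (j≢i ∘ Fin.suc-injective)))

  tabulate-AllPairs : ∀ {s} {R : Rel A 0ℓ} (f : Fin s → A) → (∀ {i j} → i Fin.< j → R (f i) (f j)) →
                      AllPairs R (Vec.tabulate f)
  tabulate-AllPairs {zero}  f mono = []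
  tabulate-AllPairs {suc s} {R} f mono = ∈-All _ (λ x∈ → above (∈⇒lookup _ x∈)) ∷
    tabulate-AllPairs (f ∘ suc) (λ i<j → mono (s≤s i<j))
    where
    above : ∀ {x} → (∃ λ p → lookup (Vec.tabulate (f ∘ suc)) p ≡ x) → R (f zero) x
    above (p , refl) = subst (R (f zero)) (sym (Vec.lookup∘tabulate (f ∘ suc) p)) (mono (s≤s z≤n))

-- Coefficients of integer combinations of cycles

module Combinations (K : SimplicialComplex) (k : ℕ) where
  H = ReducedHomology K k
  open AbelianGroup H using () renaming (Carrier to Class)

  coefficient : Class → Simplex K (suc k) → ℤ
  coefficient x = coeff K (proj₁ x)

  coeff-· : ∀ c (x : Class) σ → coefficient (_·_ H c x) σ ≡ c ℤ.* coefficient x σ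
  coeff-· (+ n)    x σ = multiple n
    where
    multiple : ∀ n → coefficient (_·_ H (+ n) x) σ ≡ (+ n) ℤ.* coefficient x σ
    multiple zero    = refl
    multiple (suc n) = trans (coeff-++ K (proj₁ x) _ σ)
      (trans (cong (ℤ._+_ (coefficient x σ)) (multiple n)) (sym (ℤ.suc-* (+ n) (coefficient x σ))))
  coeff-· -[1+ n ] x σ = trans (coeff-negate K (proj₁ (_·_ H (+ suc n) x)) σ)
    (trans (cong ℤ.-_ (coeff-· (+ suc n) x σ)) (ℤ.neg-distribˡ-* (+ suc n) (coefficient x σ)))

  coeff-combination-∷ : ∀ {r} (c : Vector ℤ (suc r)) (v : Vector Class (suc r)) σ →
    coefficient (combination H c v) σ ≡
      c zero ℤ.* coefficient (v zero) σ ℤ.+ coefficient (combination H (c ∘ suc) (v ∘ suc)) σ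
  coeff-combination-∷ c v σ = trans (coeff-++ K (proj₁ (_·_ H (c zero) (v zero))) _ σ)
    (cong (ℤ._+ coefficient (combination H (c ∘ suc) (v ∘ suc)) σ) (coeff-· (c zero) (v zero) σ))

  coeff-combination-zero : ∀ {r} (c : Vector ℤ r) (v : Vector Class r) σ →
    (∀ i → coefficient (v i) σ ≡ 0ℤ) → coefficient (combination H c v) σ ≡ 0ℤ
  coeff-combination-zero {zero}  c v σ zer = refl
  coeff-combination-zero {suc r} c v σ zer = trans (coeff-combination-∷ c v σ) (cong₂ ℤ._+_
    (trans (cong (c zero ℤ.*_) (zer zero)) (ℤ.*-zeroʳ (c zero)))
    (coeff-combination-zero (c ∘ suc) (v ∘ suc) σ (zer ∘ suc)))

  coeff-combination-single : ∀ {r} (c : Vector ℤ r) (v : Vector Class r) σ i →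
    coefficient (v i) σ ≡ 1ℤ → (∀ j → j ≢ i → coefficient (v j) σ ≡ 0ℤ) →
    coefficient (combination H c v) σ ≡ c i
  coeff-combination-single c v σ zero one zer = trans (coeff-combination-∷ c v σ) (trans
    (cong₂ ℤ._+_ (trans (cong (c zero ℤ.*_) one) (ℤ.*-identityʳ (c zero)))
                 (coeff-combination-zero (c ∘ suc) (v ∘ suc) σ (λ j → zer (suc j) λ ())))
    (ℤ.+-identityʳ (c zero)))
  coeff-combination-single c v σ (suc i) one zer = trans (coeff-combination-∷ c v σ) (trans
    (cong₂ ℤ._+_ (trans (cong (c zero ℤ.*_) (zer zero λ ())) (ℤ.*-zeroʳ (c zero)))
                 (coeff-combination-single (c ∘ suc) (v ∘ suc) σ i one
                   (λ j j≢i → zer (suc j) (j≢i ∘ Fin.suc-injective))))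
    (ℤ.+-identityˡ (c (suc i))))

-- The cross-polytope of a permutation

module CrossPolytopes {m : ℕ} (n : ℕ) (n+n≡m : n ℕ.+ n ≡ m) where
  open Doubled n n+n≡m
  open Square
  open Simplex

  col-cell : ∀ b i j → col (cell b i j) ≡ low i
  col-cell true  i j = refl
  col-cell false i j = refl

  rows-differ : ∀ b b′ {i i′ j j′} → i ≢ i′ → j ≢ j′ → row (cell b i j) ≢ row (cell b′ i′ j′)
  rows-differ true  true  i≢ j≢ eq = j≢ (high-injective _ _ eq)
  rows-differ true  false i≢ j≢ eq = ℕ.<⇒≢ (low<high _ _) (cong toℕ (sym eq))
  rows-differ false true  i≢ j≢ eq = ℕ.<⇒≢ (low<high _ _) (cong toℕ eq)
  rows-differ false false i≢ j≢ eq = i≢ (low-injective _ _ eq)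

  -- The columns increase with `i` whatever the choices are, so the vertices come out sorted and no
  -- reordering sign enters.
  cell-simplex : Fin (n !) → Vec Bool n → Simplex (St m) n
  cell-simplex k e = simplex (cells π e) (tabulate-AllPairs _ ascending) face
    where
    π = perm n k
    c : Fin n → Square m
    c i = cell (lookup e i) i (lookup π i)
    ascending : ∀ {i j} → i Fin.< j → c i <ˢ c j
    ascending {i} {j} i<j = inj₁ (subst₂ Fin._<_ (sym (col-cell (lookup e i) i _)) (sym (col-cell (lookup e j) j _))
      (subst₂ ℕ._<_ (sym (toℕ-low i)) (sym (toℕ-low j)) i<j))
    apart : ∀ p q → c p ≢ c q → col (c p) ≢ col (c q) × row (c p) ≢ row (c q)
    apart p q c≢ =
      (λ eq → p≢q (low-injective p q
        (trans (sym (col-cell (lookup e p) p _)) (trans eq (col-cell (lookup e q) q _))))) ,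
      rows-differ (lookup e p) (lookup e q) p≢q (p≢q ∘ lookup-perm-injective n k p q)
      where
      p≢q : p ≢ q
      p≢q refl = c≢ refl
    face : NonAttacking (toList (Vec.tabulate c))
    face s∈ t∈ s≢t with p , refl ← ∈⇒lookup _ s∈ | q , refl ← ∈⇒lookup _ t∈
      rewrite Vec.lookup∘tabulate c p | Vec.lookup∘tabulate c q = apart p q s≢t

  facet-simplex : Fin (n !) → Simplex (St m) n
  facet-simplex k = cell-simplex k (Vec.replicate n true)

  cell-injective : ∀ b {i j j′} → cell b i j ≡ cell true i j′ → b ≡ true × j ≡ j′
  cell-injective true  eq = refl , high-injective _ _ (cong row eq)
  cell-injective false eq = contradiction (cong toℕ (cong row eq)) (ℕ.<⇒≢ (low<high _ _))

  -- A row in the upper half reveals both the choice and the value of the permutation, so the facet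
  -- of `l` occurs in no other cross-polytope and only once in its own.
  cells-injective : ∀ k l e → cells (perm n k) e ≡ facet (perm n l) →
                    e ≡ Vec.replicate n true × k ≡ l
  cells-injective k l e eq =
    vec-ext (λ i → trans (proj₁ (entry i)) (sym (Vec.lookup-replicate i true))) ,
    perm-injective n k l (vec-ext (proj₂ ∘ entry))
    where
    vec-ext : ∀ {A : Set} {xs ys : Vec A n} → (∀ i → lookup xs i ≡ lookup ys i) → xs ≡ ys
    vec-ext {xs = xs} {ys} eq =
      trans (sym (Vec.tabulate∘lookup xs)) (trans (Vec.tabulate-cong eq) (Vec.tabulate∘lookup ys))
    entry : ∀ i → lookup e i ≡ true × lookup (perm n k) i ≡ lookup (perm n l) i
    entry i = cell-injective (lookup e i) (trans (sym (Vec.lookup∘tabulate _ i))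
      (trans (cong (λ xs → lookup xs i) eq) (lookup-facet (perm n l) i)))

  -- The boundary of the cross-polytope on the pairs {(i,i), (i, n + π i)}.
  cross-polytope : Fin (n !) → Chain (St m) n
  cross-polytope k = List.map (λ e → parity e , cell-simplex k e) (boolVecs n)

  pairing-cross-polytope : ∀ k f → ⟨_,_⟩ (St m) (cross-polytope k) f ≡
                           ∑ (boolVecs n) (λ e → parity e ℤ.* f (cells (perm n k) e))
  pairing-cross-polytope k f = ∑-map (λ e → parity e , cell-simplex k e) (boolVecs n) (weight (St m) f)

  coeff-cross-polytope-≡ : ∀ k → coeff (St m) (cross-polytope k) (facet-simplex k) ≡ 1ℤ
  coeff-cross-polytope-≡ k = begin
    coeff (St m) (cross-polytope k) (facet-simplex k)
      ≡⟨ coeff-pairing (St m) (cross-polytope k) (facet-simplex k) ⟩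
    ⟨_,_⟩ (St m) (cross-polytope k) (δ (St m) (facet (perm n k)))
      ≡⟨ pairing-cross-polytope k (δ (St m) (facet (perm n k))) ⟩
    ∑ (boolVecs n) (λ e → parity e ℤ.* δ (St m) (facet (perm n k)) (cells (perm n k) e))
      ≡⟨ ∑-boolVecs-single n _ (λ e e≢ → trans
           (cong (parity e ℤ.*_) (δ-≢ (St m) (e≢ ∘ proj₁ ∘ cells-injective k k e))) (ℤ.*-zeroʳ (parity e))) ⟩
    parity (Vec.replicate n true) ℤ.* δ (St m) (facet (perm n k)) (facet (perm n k))
      ≡⟨ cong₂ ℤ._*_ (parity-true n) (δ-≡ (St m) {c = facet (perm n k)} refl) ⟩
    1ℤ ∎

  coeff-cross-polytope-≢ : ∀ k l → k ≢ l → coeff (St m) (cross-polytope k) (facet-simplex l) ≡ 0ℤ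
  coeff-cross-polytope-≢ k l k≢l = begin
    coeff (St m) (cross-polytope k) (facet-simplex l)
      ≡⟨ coeff-pairing (St m) (cross-polytope k) (facet-simplex l) ⟩
    ⟨_,_⟩ (St m) (cross-polytope k) (δ (St m) (facet (perm n l)))
      ≡⟨ pairing-cross-polytope k (δ (St m) (facet (perm n l))) ⟩
    ∑ (boolVecs n) (λ e → parity e ℤ.* δ (St m) (facet (perm n l)) (cells (perm n k) e))
      ≡⟨ ∑-zero (boolVecs n) (λ e → trans
           (cong (parity e ℤ.*_) (δ-≢ (St m) (k≢l ∘ proj₂ ∘ cells-injective k l e))) (ℤ.*-zeroʳ (parity e))) ⟩
    0ℤ ∎

-- The homology in degree n - 1

module _ {m k : ℕ} (n+n≡m : suc k ℕ.+ suc k ≡ m) where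
  open Simplex
  open Combinations (St m) k

  private
    n = suc k

  open Doubled n n+n≡m
  open CrossPolytopes n n+n≡m

  -- Flipping the choice at i changes the parity but not the face omitting i.
  ∂-cross-polytope : ∀ p → _≈ᶜ_ (St m) (∂ (St m) (cross-polytope p)) []
  ∂-cross-polytope p σ = begin
    coeff (St m) (∂ (St m) (cross-polytope p)) σ
      ≡⟨ coeff-pairing (St m) (∂ (St m) (cross-polytope p)) σ ⟩
    ⟨_,_⟩ (St m) (∂ (St m) (cross-polytope p)) d
      ≡⟨ ⟨∂,⟩ (St m) (cross-polytope p) d ⟩
    ⟨_,_⟩ (St m) (cross-polytope p) (coboundary (St m) d)
      ≡⟨ pairing-cross-polytope p (coboundary (St m) d) ⟩
    ∑ (boolVecs n) (λ e → parity e ℤ.* coboundary (St m) d (c e))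
      ≡⟨ ∑-cong (boolVecs n) (λ e → sym (∑-*ˡ (parity e) (allFin n) (λ i → sign (toℕ i) ℤ.* d (removeAt (c e) i)))) ⟩
    ∑ (boolVecs n) (λ e → ∑ (allFin n) (term e))
      ≡⟨ ∑-swap (boolVecs n) (allFin n) term ⟩
    ∑ (allFin n) (λ i → ∑ (boolVecs n) (λ e → term e i))
      ≡⟨ ∑-zero (allFin n) (λ i → ∑-boolVecs-alternating n (λ e → term e i) i (alternating i)) ⟩
    0ℤ ∎
    where
    d = δ (St m) (vertices σ)
    c = cells (perm n p)
    term : Vec Bool n → Fin n → ℤ
    term e i = parity e ℤ.* (sign (toℕ i) ℤ.* d (removeAt (c e) i))
    alternating : ∀ i e → term (Vec.updateAt e i not) i ≡ ℤ.- term e i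
    alternating i e = trans
      (cong₂ (λ a u → a ℤ.* (sign (toℕ i) ℤ.* d u)) (parity-flip e i)
        (removeAt-tabulate-cong i (λ j j≢i → cong (λ b → cell b j (lookup (perm n p) j))
          (Vec.lookup∘updateAt′ j i {f = not} j≢i e))))
      (sym (ℤ.neg-distribˡ-* (parity e) _))

  cross-polytope-cycle : Vector (Cycle (St m) k) (n !)
  cross-polytope-cycle p = cross-polytope p , ∂-cross-polytope p

  -- By `facet-maximal` this simplex is a face of no larger one. Its coefficient in a cycle thus
  -- depends on the homology class only.
  coeff-∂-facet : ∀ (w : Chain (St m) (suc n)) p → coeff (St m) (∂ (St m) w) (facet-simplex p) ≡ 0ℤ
  coeff-∂-facet w p = trans (coeff-∂ (St m) w (facet-simplex p))
    (∑-zero w λ (a , ρ) → trans (cong (a ℤ.*_) (incidence-zero (St m) (facet-maximal p ρ))) (ℤ.*-zeroʳ a))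

  -- Boundaries vanish at the facets, and the coefficient at facet `i` singles out the
  -- cross-polytope of `i`.
  independent : LinearlyIndependent H cross-polytope-cycle
  independent c (w , ≈∂w) i = begin
    c i
      ≡⟨ coeff-combination-single c cross-polytope-cycle (facet-simplex i) i
           (coeff-cross-polytope-≡ i) (λ j → coeff-cross-polytope-≢ j i) ⟨
    coefficient (combination H c cross-polytope-cycle) (facet-simplex i)
      ≡⟨ ≈∂w (facet-simplex i) ⟩
    coeff (St m) (∂ (St m) w) (facet-simplex i)
      ≡⟨ coeff-∂-facet w i ⟩
    0ℤ ∎

  -- Clearing the extendable perfect placements keeps the facet coefficients at 0, so no perfect
  -- placement remains in the chain, which then lies in the star cluster and bounds.
  facet-free⇒boundary : ∀ (z : Cycle (St m) k) → (∀ p → coefficient z (facet-simplex p) ≡ 0ℤ) →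
                        ∃ λ w → ∀ σ → coefficient z σ ℤ.+ coeff (St m) (∂ (St m) w) σ ≡ 0ℤ
  facet-free⇒boundary (z , ∂z≈0) facets≡0 = correction z ++ proj₁ rest , λ σ → begin
    coeff (St m) z σ ℤ.+ coeff (St m) (∂ (St m) (correction z ++ proj₁ rest)) σ
      ≡⟨ cong (ℤ._+_ (coeff (St m) z σ)) (coeff-∂-++ (St m) (correction z) (proj₁ rest) σ) ⟩
    coeff (St m) z σ ℤ.+ (coeff (St m) (∂ (St m) (correction z)) σ ℤ.+ coeff (St m) (∂ (St m) (proj₁ rest)) σ)
      ≡⟨ ℤ.+-assoc (coeff (St m) z σ) _ _ ⟨
    coeff (St m) z σ ℤ.+ coeff (St m) (∂ (St m) (correction z)) σ ℤ.+ coeff (St m) (∂ (St m) (proj₁ rest)) σ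
      ≡⟨ cong (ℤ._+ coeff (St m) (∂ (St m) (proj₁ rest)) σ) (coeff-++ (St m) z (∂ (St m) (correction z)) σ) ⟨
    coeff (St m) (eliminate z) σ ℤ.+ coeff (St m) (∂ (St m) (proj₁ rest)) σ
      ≡⟨ proj₂ rest σ ⟩
    0ℤ ∎
    where
    open Elimination (St m) {n} (PerfectExtendable) (perfectExtendable?) (extension) (extended)
      (λ τ u q q≢p → extended-face-¬perfect τ u q q≢p ∘ proj₁)

    facet-coeff : ∀ ω → (∃ λ p → vertices ω ≡ facet (perm n p)) → coeff (St m) z ω ≡ 0ℤ
    facet-coeff ω (p , eq) = trans (coeff-cong ω (facet-simplex p) eq) (facets≡0 p)
      where
      coeff-cong : ∀ σ τ → vertices σ ≡ vertices τ → coeff (St m) z σ ≡ coeff (St m) z τ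
      coeff-cong σ τ eq = trans (coeff-pairing (St m) z σ)
        (trans (cong (λ u → ⟨_,_⟩ (St m) z (δ (St m) u)) eq) (sym (coeff-pairing (St m) z τ)))

    -- The face at the position of the new rook is `τ`, which is extendable, unlike `ω`; every other
    -- face fails to be perfect, unlike `ω`.
    not-face : ∀ ω → Perfect (vertices ω) → ¬ Extendable (vertices ω) →
               ∀ τ u q → removeAt (vertices (Coface.coface (extended τ u))) q ≢ vertices ω
    not-face ω perfect ¬ext τ u q eq with q Fin.≟ Coface.position (extended τ u)
    ... | yes refl = ¬ext (subst Extendable (trans (sym (Coface.omit-≡ (extended τ u))) eq) (proj₂ u))
    ... | no  q≢p  = extended-face-¬perfect τ u q q≢p (subst Perfect (sym eq) perfect)

    supported : SupportedBelow m (eliminate z)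
    supported ω below with extendable? (vertices ω)
    ... | yes ext = eliminated z ω ((λ i → below i (Fin.toℕ<n i)) , ext)
    ... | no ¬ext = trans (unaffected z ω (not-face ω perfect ¬ext))
                          (facet-coeff ω (perfect-¬extendable⇒facet ω perfect ¬ext))
      where
      perfect : Perfect (vertices ω)
      perfect i = below i (Fin.toℕ<n i)

    ∂eliminate≈0 : _≈ᶜ_ (St m) (∂ (St m) (eliminate z)) []
    ∂eliminate≈0 σ = trans (coeff-∂-++ (St m) z (∂ (St m) (correction z)) σ)
                           (cong₂ ℤ._+_ (∂z≈0 σ) (∂∂≈0 (St m) (correction z) σ))

    rest = supportedBelow⇒boundary m ℕ.≤-refl (eliminate z) ∂eliminate≈0 supported

  -- Subtracting from `x` the cross-polytopes, weighted by the facet coefficients of `x`, gives a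
  -- cycle that vanishes at all facets and therefore bounds.
  maximal : ∀ x → LinearlyDependent H (x Vector.∷ cross-polytope-cycle)
  -- The coefficient 1 of `x` makes the relation nontrivial. The chain `w` fills the negative of the
  -- combination, whence `negate`.
  maximal x = c , (zero , λ ()) , negate (St m) w , λ σ →
    trans (solve-sum (coefficient z σ) (coeff (St m) (∂ (St m) w) σ) (proj₂ fill σ)) (sym (coeff-∂-negate (St m) w σ))
    where
    c : Vector ℤ (suc (n !))
    c = 1ℤ Vector.∷ λ p → ℤ.- coefficient x (facet-simplex p)
    z = combination H c (x Vector.∷ cross-polytope-cycle)
    facets≡0 : ∀ p → coefficient z (facet-simplex p) ≡ 0ℤ
    facets≡0 p = begin
      coefficient z φ
        ≡⟨ coeff-combination-∷ c (x Vector.∷ cross-polytope-cycle) φ ⟩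
      1ℤ ℤ.* coefficient x φ ℤ.+ coefficient (combination H (c ∘ suc) cross-polytope-cycle) φ
        ≡⟨ cong₂ ℤ._+_ (ℤ.*-identityˡ (coefficient x φ))
             (coeff-combination-single (c ∘ suc) cross-polytope-cycle φ p
               (coeff-cross-polytope-≡ p) (λ j → coeff-cross-polytope-≢ j p)) ⟩
      coefficient x φ ℤ.+ ℤ.- coefficient x φ
        ≡⟨ ℤ.+-inverseʳ (coefficient x φ) ⟩
      0ℤ ∎
      where φ = facet-simplex p
    solve-sum : ∀ a b → a ℤ.+ b ≡ 0ℤ → a ≡ ℤ.- b
    solve-sum a b eq = trans (lemma a b) (trans (cong (ℤ._- b) eq) (ℤ.+-identityˡ (ℤ.- b)))
      where
      lemma : ∀ a b → a ≡ a ℤ.+ b ℤ.- b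
      lemma = solve-∀
    fill = facet-free⇒boundary z facets≡0
    w = proj₁ fill

corollary5p7 : ∀ (n : ℕ) → n ≥ 1 → HasReducedBetti (St (2 * n)) (n ∸ 1) (n !)
corollary5p7 (suc k) _ = cross-polytope-cycle eq , independent eq , maximal eq
  where
  eq : suc k ℕ.+ suc k ≡ 2 * suc k
  -- `2 * suc k` unfolds to `suc k + (suc k + 0)`.
  eq = cong (suc k ℕ.+_) (sym (ℕ.+-identityʳ (suc k)))
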